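{- Let $\mathcal{G}$ be any one of the classes of threshold, interval, split, cocomparability, or chordal graphs, and let $P(\mathcal{G})$ be its associated set of forbidden patterns, namely $P(\text{threshold})=\{p_1,p_2\}$, $P(\text{interval})=\{p_1,p_4\}$, $P(\text{split})=\{p_1,p_3\}$, $P(\text{cocomparability})=\{p_4\}$, $P(\text{chordal})=\{p_1\}$. Then for every $G=(V,E)\in\mathcal{G}$ and every ordering $\sigma$ of $V$ that is $p$-free with respect to $G$ for all $p\in P(\mathcal{G})$, there is an ordering of the vertex set $E$ of $L^2(G)$ that is $p$-free with respect to $L^2(G)$ for all $p\in P(\mathcal{G})$ (so that, in particular, $L^2(G)\in\mathcal{G}$). Moreover, such an ordering of $E$ can be computed from $G$ and $\sigma$ in time linear in the size of $G$, i.e. $\mathcal{O}(|V|+|E|)$.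
   Context: All graphs are finite and simple, and given by adjacency lists. An ordering of a finite set $X$ is a bijection $X\to\{1,\dots,|X|\}$, and $x\prec y$ means that $x$ comes before $y$. The line graph $L(G)$ has vertex set $E$, two distinct edges of $G$ being adjacent iff they share an endpoint. The square $H^2$ of a graph $H$ has the same vertex set as $H$, and two distinct vertices are adjacent in $H^2$ iff their distance in $H$ is at most $2$. $L^2(G)=(L(G))^2$. Patterns on three vertices. Let $H$ be a graph with an ordering of its vertices. Three vertices $x\prec y\prec z$ induce, in $H$: - $p_1$ if $xz,yz$ are edges and $xy$ is not an edge; - $p_2$ if $xy$ is an edge and $xz,yz$ are not edges; - $p_3$ if $yz$ is an edge and $xy,xz$ are not edges; - $p_4$ if $xz$ is an edge and $xy,yz$ are not edges. The ordering is $p_i$-free with respect to $H$ if no three vertices $x\prec y\prec z$ of $H$ induce $p_i$. Vertex ordering characterizations (known): for each class $\mathcal{G}$ listed, a graph $H$ belongs to $\mathcal{G}$ if and only if $H$ has a vertex ordering that is $p$-free for all $p\in P(\mathcal{G})$. Here a comparability graph is a graph admitting a transitive orientation of its edges, and a cocomparability graph is the complement of a comparability graph. -}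

module Defs where

open import Data.Bool using (Bool; true; false)
open import Data.Fin using (Fin; toℕ) renaming (_<_ to _<ᶠ_)
open import Data.List using (List; []; _∷_; allFin; concat; length; map)
open import Data.List.Membership.Propositional using (_∈_; _∉_)
open import Data.List.Relation.Unary.Unique.Propositional using (Unique)
open import Data.List.Scans.Base using (scanl)
open import Data.Nat using (ℕ; zero; suc; pred; _+_; _≤_; _<_; _≟_)
import Data.Rational as ℚ
open ℚ using (ℚ)
open import Data.Product using (Σ-syntax; ∃-syntax; _×_; _,_)
open import Data.Sum using (_⊎_)
open import Function using (_⇔_; _⤖_; Injective; module Bijection)
open import Level using (Lift; 0ℓ) renaming (suc to lsuc)
open import Relation.Binary.PropositionalEquality
  using (_≡_; _≢_; refl; sym)
open import Relation.Nullary using (¬_; yes; no)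

-- Finiteness is not a field: it is part of the data of an Ordering below,
-- and of the adjacency lists by which input graphs are given.

record Graph : Set₁ where
  infix 4 _~_
  field
    Vertex   : Set
    _~_      : Vertex → Vertex → Set
    ~-sym    : ∀ {x y} → x ~ y → y ~ x
    ~-irrefl : ∀ {x} → ¬ (x ~ x)

open Graph public using (Vertex)

record AdjacencyLists : Set where
  field
    order      : ℕ
    nbrs       : Fin order → List (Fin order)
    unique     : ∀ v → Unique (nbrs v)
    loopless   : ∀ v → v ∉ nbrs v
    symmetric  : ∀ {u v} → v ∈ nbrs u → u ∈ nbrs v

open AdjacencyLists public using (order; nbrs)

⟦_⟧ : AdjacencyLists → Graph
⟦ G ⟧ = record
  { Vertex   = Fin (order G)
  ; _~_      = λ u v → v ∈ nbrs G u
  ; ~-sym    = AdjacencyLists.symmetric G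
  ; ~-irrefl = AdjacencyLists.loopless G _
  }

-- An unordered edge {u,v} is represented once, with its smaller label
-- first.  The proofs are irrelevant, so that two edges with the same
-- endpoints are equal.

record Edge (G : AdjacencyLists) : Set where
  field
    src tgt   : Fin (order G)
    .src<tgt  : src <ᶠ tgt
    .adjacent : tgt ∈ nbrs G src

open Edge public using (src; tgt)

_EndpointOf_ : ∀ {G} → Fin (order G) → Edge G → Set
v EndpointOf e = v ≡ src e ⊎ v ≡ tgt e

L : AdjacencyLists → Graph
L G = record
  { Vertex   = Edge G
  ; _~_      = λ e f → e ≢ f × ∃[ v ] (v EndpointOf e × v EndpointOf f)
  ; ~-sym    = λ { (e≢f , v , p , q) → (λ f≡e → e≢f (sym f≡e)) , v , q , p }
  ; ~-irrefl = λ { (e≢e , _) → e≢e refl }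
  }

module _ (H : Graph) where
  open Graph H using (_~_; ~-sym)

  data Walk : ℕ → Vertex H → Vertex H → Set where
    []  : ∀ {x} → Walk 0 x x
    _∷_ : ∀ {k x y z} → x ~ y → Walk k y z → Walk (suc k) x z

  Distance≤ : ℕ → Vertex H → Vertex H → Set
  Distance≤ d x y = ∃[ k ] (k ≤ d × Walk k x y)

  private
    snoc : ∀ {k x y z} → Walk k x y → y ~ z → Walk (suc k) x z
    snoc []      e = e ∷ []
    snoc (f ∷ w) e = f ∷ snoc w e

    reverse : ∀ {k x y} → Walk k x y → Walk k y x
    reverse []      = []
    reverse (e ∷ w) = snoc (reverse w) (~-sym e)

  _² : Graph
  _² = record
    { Vertex   = Vertex H
    ; _~_      = λ x y → x ≢ y × Distance≤ 2 x y
    ; ~-sym    = λ { (x≢y , k , k≤2 , w) →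
                     (λ y≡x → x≢y (sym y≡x)) , k , k≤2 , reverse w }
    ; ~-irrefl = λ { (x≢x , _) → x≢x refl }
    }

L² : AdjacencyLists → Graph
L² G = (L G) ²

-- Positions are counted from 0; necessarily size = |X|.

record Ordering (X : Set) : Set where
  field
    size      : ℕ
    bijection : X ⤖ Fin size

  position : X → Fin size
  position = Bijection.to bijection

  infix 4 _≺_
  _≺_ : X → X → Set
  x ≺ y = position x <ᶠ position y

open Ordering public using (size; position)

data Pattern : Set where
  p₁ p₂ p₃ p₄ : Pattern

module _ (H : Graph) where
  open Graph H using (_~_)

  -- To be read for x ≺ y ≺ z.
  Induces : Pattern → Vertex H → Vertex H → Vertex H → Set
  Induces p₁ x y z = x ~ z × y ~ z × ¬ (x ~ y)
  Induces p₂ x y z = x ~ y × ¬ (x ~ z) × ¬ (y ~ z)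
  Induces p₃ x y z = y ~ z × ¬ (x ~ y) × ¬ (x ~ z)
  Induces p₄ x y z = x ~ z × ¬ (x ~ y) × ¬ (y ~ z)

  Free : Pattern → Ordering (Vertex H) → Set
  Free p σ = ∀ {x y z} → x ≺ y → y ≺ z → ¬ Induces p x y z
    where open Ordering σ using (_≺_)

data Class : Set where
  threshold interval split cocomparability chordal : Class

P : Class → List Pattern
P threshold       = p₁ ∷ p₂ ∷ []
P interval        = p₁ ∷ p₄ ∷ []
P split           = p₁ ∷ p₃ ∷ []
P cocomparability = p₄ ∷ []
P chordal         = p₁ ∷ []

PatternFree : Class → (H : Graph) → Ordering (Vertex H) → Set
PatternFree 𝒢 H σ = ∀ {p} → p ∈ P 𝒢 → Free H p σ

complement : Graph → Graph
complement H = record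
  { Vertex   = Vertex H
  ; _~_      = λ x y → x ≢ y × ¬ (x ~ y)
  ; ~-sym    = λ { (x≢y , x≁y) →
                   (λ y≡x → x≢y (sym y≡x)) , (λ y~x → x≁y (~-sym y~x)) }
  ; ~-irrefl = λ { (x≢x , _) → x≢x refl }
  }
  where open Graph H

-- Cyclically: the last index is followed by 0.
Successive : ∀ {k} → Fin k → Fin k → Set
Successive {k} i j =
  toℕ j ≡ suc (toℕ i) ⊎ (suc (toℕ i) ≡ k × toℕ j ≡ 0)

module _ (H : Graph) where
  open Graph H using (_~_)

  -- Adjacency is "weight sum exceeds t".  For finite graphs rational and
  -- real weights give the same class; likewise for interval endpoints.
  Threshold : Set
  Threshold = Σ[ w ∈ (Vertex H → ℚ) ] ∃[ t ]
    (∀ x y → x ≢ y → (x ~ y) ⇔ (t ℚ.< w x ℚ.+ w y))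

  -- Intersection graphs of closed intervals [l x , r x].
  Interval : Set
  Interval = Σ[ l ∈ (Vertex H → ℚ) ] Σ[ r ∈ (Vertex H → ℚ) ]
    ((∀ x → l x ℚ.≤ r x) ×
     (∀ x y → x ≢ y → (x ~ y) ⇔ (l x ℚ.≤ r y × l y ℚ.≤ r x)))

  Split : Set
  Split = Σ[ inClique ∈ (Vertex H → Bool) ]
    ((∀ x y → inClique x ≡ true → inClique y ≡ true → x ≢ y → x ~ y) ×
     (∀ x y → inClique x ≡ false → inClique y ≡ false → ¬ (x ~ y)))

  Comparability : Set₁
  Comparability = Σ[ _⟶_ ∈ (Vertex H → Vertex H → Set) ]
    ((∀ x y → (x ~ y) ⇔ (x ⟶ y ⊎ y ⟶ x)) ×
     (∀ x y → x ⟶ y → ¬ (y ⟶ x)) ×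
     (∀ x y z → x ⟶ y → y ⟶ z → x ⟶ z))

  Chordal : Set
  Chordal = ∀ k (c : Fin k → Vertex H) → 4 ≤ k → Injective _≡_ _≡_ c →
    (∀ i j → Successive i j → c i ~ c j) →
    ∃[ i ] ∃[ j ] (¬ Successive i j × ¬ Successive j i × c i ~ c j)

infix 4 _∈Class_
_∈Class_ : Graph → Class → Set₁
H ∈Class threshold       = Lift (lsuc 0ℓ) (Threshold H)
H ∈Class interval        = Lift (lsuc 0ℓ) (Interval H)
H ∈Class split           = Lift (lsuc 0ℓ) (Split H)
H ∈Class cocomparability = Comparability (complement H)
H ∈Class chordal         = Lift (lsuc 0ℓ) (Chordal H)

-- A unit-cost random access machine.  A program names finitely many
-- registers and arrays of natural numbers.  Arithmetic is limited to
-- successor and predecessor, so a run of t steps produces no number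
-- larger than t plus the largest constant or input.  Hence on linear-time
-- runs all numbers have O(log) bits, and unit cost is also the word-RAM
-- cost.  Interleaving the arrays in one memory costs a constant factor.

Register Array : Set
Register = ℕ
Array    = ℕ

infixr 5 _⨾_

data Program : Set where
  skip            : Program
  const           : Register → ℕ → Program
  copy            : Register → Register → Program
  inc dec         : Register → Program
  load            : Register → Array → Register → Program
  store           : Array → Register → Register → Program
  _⨾_             : Program → Program → Program
  if_<_then_else_ : Register → Register → Program → Program → Program
  while_<_loop_   : Register → Register → Program → Program

record State : Set where
  constructor state
  field
    reg : Register → ℕ
    arr : Array → ℕ → ℕ

open State public

update : {A : Set} → (ℕ → A) → ℕ → A → (ℕ → A)
update f i a j with i ≟ j
... | yes _ = a
... | no  _ = f j

setReg : State → Register → ℕ → State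
setReg s r a = state (update (reg s) r a) (arr s)

setArr : State → Array → ℕ → ℕ → State
setArr s b i a = state (reg s) (update (arr s) b (update (arr s b) i a))

-- Run p s s′ t: started in s, the program p halts in s′ after t steps.
data Run : Program → State → State → ℕ → Set where
  skip  : ∀ {s} → Run skip s s 1
  const : ∀ {s r k} → Run (const r k) s (setReg s r k) 1
  copy  : ∀ {s r q} → Run (copy r q) s (setReg s r (reg s q)) 1
  inc   : ∀ {s r} → Run (inc r) s (setReg s r (suc (reg s r))) 1
  dec   : ∀ {s r} → Run (dec r) s (setReg s r (pred (reg s r))) 1
  load  : ∀ {s r a i} →
          Run (load r a i) s (setReg s r (arr s a (reg s i))) 1
  store : ∀ {s a i r} →
          Run (store a i r) s (setArr s a (reg s i) (reg s r)) 1
  _⨾_   : ∀ {p q s s′ s″ t u} →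
          Run p s s′ t → Run q s′ s″ u → Run (p ⨾ q) s s″ (t + u)
  if-true     : ∀ {i j p q s s′ t} → reg s i < reg s j →
                Run p s s′ t → Run (if i < j then p else q) s s′ (suc t)
  if-false    : ∀ {i j p q s s′ t} → ¬ (reg s i < reg s j) →
                Run q s s′ t → Run (if i < j then p else q) s s′ (suc t)
  while-true  : ∀ {i j p s s′ s″ t u} → reg s i < reg s j →
                Run p s s′ t → Run (while i < j loop p) s′ s″ u →
                Run (while i < j loop p) s s″ (suc (t + u))
  while-false : ∀ {i j p s} → ¬ (reg s i < reg s j) →
                Run (while i < j loop p) s s 1

cells : List ℕ → ℕ → ℕ
cells []       _       = 0
cells (a ∷ _)  zero    = a
cells (_ ∷ as) (suc i) = cells as i

-- Register 0 holds |V|.  Array 1 holds the adjacency lists one after the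
-- other, the list of v occupying the cells from (array 0)[v] up to but
-- excluding (array 0)[v + 1].  Array 2 holds the position of each vertex
-- in σ.  All other memory is 0.
input : (G : AdjacencyLists) → Ordering (Fin (order G)) → State
input G σ = state registers arrays
  where
  lists : List (List ℕ)
  lists = map (λ v → map toℕ (nbrs G v)) (allFin (order G))

  registers : Register → ℕ
  registers 0 = order G
  registers _ = 0

  arrays : Array → ℕ → ℕ
  arrays 0 = cells (scanl _+_ 0 (map length lists))
  arrays 1 = cells (concat lists)
  arrays 2 = cells (map (λ v → toℕ (position σ v)) (allFin (order G)))
  arrays _ = λ _ → 0

-- The edges are listed in the order τ, by their endpoints, in arrays 3
-- and 4.
Outputs : (G : AdjacencyLists) → State → Ordering (Edge G) → Set
Outputs G s τ = ∀ e →
  arr s 3 (toℕ (position τ e)) ≡ toℕ (src e) ×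
  arr s 4 (toℕ (position τ e)) ≡ toℕ (tgt e)

{-# OPTIONS --safe #-}

-- Order the edges by the position of their earlier endpoint, ties arbitrary.
-- Two edges are adjacent in L² iff some endpoint of one equals or is adjacent
-- to some endpoint of the other.  For p₁-free orderings edges then behave as
-- subtrees rooted at their first endpoint (and for p₁,p₄-free ones as
-- intervals); for p₄-free orderings non-adjacent edges lie entirely one before
-- the other; and p₂-free or p₃-free orderings exclude induced 2K₂, so that L²
-- is complete.  The program inverts σ and emits, vertex by vertex in the order
-- σ, the later neighbours of each vertex.

module Submission where

open import Defs
open import Data.Bool using (true)
open import Data.Empty using (⊥-elim)
open import Data.Fin using (Fin; toℕ; fromℕ; fromℕ<; inject₁)
  renaming (zero to fzero; suc to fsuc; _<_ to _<ᶠ_)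
import Data.Fin.Properties as Fin
open import Data.List using (List; []; _∷_; [_]; _++_; _∷ʳ_; map; concat; concatMap; filter;
  length; lookup; tabulate; allFin)
open import Data.List.Membership.DecPropositional using (_∈?_)
open import Data.List.Membership.Propositional using (_∈_)
open import Data.List.Membership.Propositional.Properties
import Data.List.Properties as List
open import Data.List.Relation.Unary.All as All using ()
import Data.List.Relation.Unary.All.Properties as All
open import Data.List.Relation.Unary.AllPairs as AllPairs using (AllPairs; _∷_)
import Data.List.Relation.Unary.AllPairs.Properties as AllPairs
open import Data.List.Relation.Unary.Any using (here; there; index)
open import Data.List.Relation.Unary.Any.Properties using (lookup-index)
open import Data.List.Relation.Unary.Unique.Propositional using (Unique)
open import Data.List.Scans.Base using (scanl)
open import Data.Nat using (ℕ; zero; suc; _+_; _*_; _≤_; _<_; _⊓_; _⊔_; z≤n; s≤s; _≟_; _<?_)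
import Data.Nat.Properties as ℕ
open import Data.Nat.Solver using (module +-*-Solver)
open import Data.Product using (Σ-syntax; ∃-syntax; _×_; _,_; proj₁; proj₂; swap)
import Data.Rational as ℚ
open ℚ using (ℚ)
import Data.Rational.Properties as ℚ
open import Data.Sum as Sum using (_⊎_; inj₁; inj₂; [_,_]′)
open import Function using (_∘_; Injective; mk⇔; mk⤖; module Bijection; module Equivalence)
open import Level using (0ℓ; lift)
open import Relation.Binary.Core using (Rel)
open import Relation.Binary.Definitions using (tri<; tri≈; tri>)
open import Relation.Binary.PropositionalEquality hiding ([_])
open import Relation.Nullary using (¬_; Dec; yes; no)
open import Relation.Nullary.Decidable
  using (recompute; map′; _×-dec_; _⊎-dec_; ¬?; True; toWitness)

-- Adjacency in L²

-- One edge ordering and one program serve all five classes; the class enters only through the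
-- patterns that σ avoids. The obstacle is that an `Edge` stores its endpoints by label, whereas
-- every argument runs along σ. Each edge is therefore also viewed as a pair pointing forward in σ,
-- from which the labels are recovered as minimum and maximum.
--
-- Time is linear although the program reads every cell of the adjacency lists and discards the
-- backward entries: each edge accounts for at most two cells, so the number of cells is bounded by
-- twice the number of emitted edges.
--
-- Class membership of L² has three sources: completeness for threshold and split graphs, the new
-- ordering for cocomparability and chordal graphs, and the given intervals themselves for interval
-- graphs.

module Adjacency (G : AdjacencyLists) where

  private V = Fin (order G)

  edge-≡ : {e f : Edge G} → src e ≡ src f → tgt e ≡ tgt f → e ≡ f
  edge-≡ {record {}} {record {}} refl refl = refl

  src<tgt : (e : Edge G) → toℕ (src e) < toℕ (tgt e)
  src<tgt record { src = u ; tgt = v ; src<tgt = u<v } =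
    recompute (toℕ u ℕ.<? toℕ v) u<v

  src~tgt : (e : Edge G) → tgt e ∈ nbrs G (src e)
  src~tgt record { src = u ; tgt = v ; adjacent = uv } =
    recompute (_∈?_ Fin._≟_ v (nbrs G u)) uv

  _≟ᴱ_ : (e f : Edge G) → Dec (e ≡ f)
  e ≟ᴱ f = map′ (λ (p , q) → edge-≡ p q) (λ { refl → refl , refl })
    (src e Fin.≟ src f ×-dec tgt e Fin.≟ tgt f)

  open Graph ⟦ G ⟧ using (_~_; ~-sym; ~-irrefl)

  _~?_ : (u v : V) → Dec (u ~ v)
  u ~? v = _∈?_ Fin._≟_ v (nbrs G u)

  edgeBetween : ∀ {u v} → u ~ v → Σ[ e ∈ Edge G ] (u EndpointOf e × v EndpointOf e)
  edgeBetween {u} {v} uv with Fin.<-cmp u v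
  ... | tri< u<v _ _ = record { src<tgt = u<v ; adjacent = uv } , inj₁ refl , inj₂ refl
  ... | tri≈ _ refl _ = ⊥-elim (~-irrefl uv)
  ... | tri> _ _ v<u = record { src<tgt = v<u ; adjacent = ~-sym uv } , inj₂ refl , inj₁ refl

  Near : V → V → Set
  Near u v = u ≡ v ⊎ u ~ v

  near-sym : ∀ {u v} → Near u v → Near v u
  near-sym = Sum.map sym ~-sym

  near? : ∀ u v → Dec (Near u v)
  near? u v = u Fin.≟ v ⊎-dec u ~? v

  endpoints-near : ∀ {e : Edge G} {u v} → u EndpointOf e → v EndpointOf e → Near u v
  endpoints-near (inj₁ refl) (inj₁ refl) = inj₁ refl
  endpoints-near {e} (inj₁ refl) (inj₂ refl) = inj₂ (src~tgt e)
  endpoints-near {e} (inj₂ refl) (inj₁ refl) = inj₂ (~-sym (src~tgt e))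
  endpoints-near (inj₂ refl) (inj₂ refl) = inj₁ refl

  -- Unlike adjacency in `L² G` this relation is reflexive, so the pattern arguments need not
  -- separate equal edges; distinctness returns only in `meets⇒adjacent`.
  Meets : Edge G → Edge G → Set
  Meets e f = ∃[ u ] ∃[ v ] (u EndpointOf e × v EndpointOf f × Near u v)

  meets-sym : ∀ {e f} → Meets e f → Meets f e
  meets-sym (u , v , p , q , n) = v , u , q , p , near-sym n

  meets? : ∀ e f → Dec (Meets e f)
  meets? e f = map′
    [ [ (λ n → src e , src f , inj₁ refl , inj₁ refl , n)
      , (λ n → src e , tgt f , inj₁ refl , inj₂ refl , n) ]′
    , [ (λ n → tgt e , src f , inj₂ refl , inj₁ refl , n)
      , (λ n → tgt e , tgt f , inj₂ refl , inj₂ refl , n) ]′ ]′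
    (λ { (_ , _ , inj₁ refl , inj₁ refl , n) → inj₁ (inj₁ n)
       ; (_ , _ , inj₁ refl , inj₂ refl , n) → inj₁ (inj₂ n)
       ; (_ , _ , inj₂ refl , inj₁ refl , n) → inj₂ (inj₁ n)
       ; (_ , _ , inj₂ refl , inj₂ refl , n) → inj₂ (inj₂ n) })
    ((near? (src e) (src f) ⊎-dec near? (src e) (tgt f)) ⊎-dec
     (near? (tgt e) (src f) ⊎-dec near? (tgt e) (tgt f)))

  open Graph (L² G) using () renaming (_~_ to _~²_)

  adjacent⇒meets : ∀ {e f} → e ~² f → Meets e f
  adjacent⇒meets (e≢f , _ , _ , []) = ⊥-elim (e≢f refl)
  adjacent⇒meets (_ , _ , _ , (_ , u , p , q) ∷ []) = u , u , p , q , inj₁ refl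
  adjacent⇒meets (_ , _ , _ , _∷_ {y = g} (_ , u , p , q) ((_ , v , r , s) ∷ [])) =
    u , v , p , s , endpoints-near {e = g} q r
  adjacent⇒meets (_ , _ , s≤s (s≤s ()) , _ ∷ (_ ∷ (_ ∷ _)))

  meets⇒adjacent : ∀ {e f} → e ≢ f → Meets e f → e ~² f
  meets⇒adjacent e≢f (u , _ , p , q , inj₁ refl) =
    e≢f , 1 , s≤s z≤n , (e≢f , u , p , q) ∷ []
  -- The connecting edge uv may be e or f itself. The line graph has no loops, so the walk then
  -- shrinks to a single step.
  meets⇒adjacent {e} {f} e≢f (u , v , p , q , inj₂ uv)
    with g , r , s ← edgeBetween uv | e ≟ᴱ g | g ≟ᴱ f
  ... | yes refl | _ = e≢f , 1 , s≤s z≤n , (e≢f , v , s , q) ∷ []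
  ... | no _ | yes refl = e≢f , 1 , s≤s z≤n , (e≢f , u , p , r) ∷ []
  ... | no e≢g | no g≢f =
    e≢f , 2 , s≤s (s≤s z≤n) , (e≢g , u , p , r) ∷ ((g≢f , v , s , q) ∷ [])

  adjacent? : ∀ e f → Dec (e ~² f)
  adjacent? e f = map′ (λ (e≢f , m) → meets⇒adjacent e≢f m)
    (λ e~²f → proj₁ e~²f , adjacent⇒meets e~²f) (¬? (e ≟ᴱ f) ×-dec meets? e f)

-- Forbidden patterns of σ and pairs of edges

module _ {X : Set} (σ : Ordering X) where
  open Ordering σ using (_≺_)

  position-injective : ∀ {x y} → position σ x ≡ position σ y → x ≡ y
  position-injective = Bijection.injective (Ordering.bijection σ)

  ≺⇒≢ : ∀ {x y} → x ≺ y → x ≢ y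
  ≺⇒≢ x≺y refl = ℕ.<-irrefl refl x≺y

  compare : ∀ x y → x ≺ y ⊎ x ≡ y ⊎ y ≺ x
  compare x y with Fin.<-cmp (position σ x) (position σ y)
  ... | tri< x≺y _ _ = inj₁ x≺y
  ... | tri≈ _ x≡y _ = inj₂ (inj₁ (position-injective x≡y))
  ... | tri> _ _ y≺x = inj₂ (inj₂ y≺x)

  ≤⇒≺⊎≡ : ∀ {x y} → toℕ (position σ x) ≤ toℕ (position σ y) → x ≺ y ⊎ x ≡ y
  ≤⇒≺⊎≡ {x} {y} x≼y with compare x y
  ... | inj₁ x≺y = inj₁ x≺y
  ... | inj₂ (inj₁ x≡y) = inj₂ x≡y
  ... | inj₂ (inj₂ y≺x) = ⊥-elim (ℕ.<⇒≱ y≺x x≼y)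

module _ (G : AdjacencyLists) (σ : Ordering (Fin (order G))) where
  open Graph ⟦ G ⟧
  open Adjacency G
  open Ordering σ using (_≺_)

  -- Hides which of `src` and `tgt` comes earlier in σ. The last two fields lead back from the
  -- oriented pair to the stored labels: they make `dart` injective and identify the pair that the
  -- program writes.
  record Orientation (e : Edge G) : Set where
    field
      first last  : Fin (order G)
      first∈      : first EndpointOf e
      last∈       : last EndpointOf e
      only        : ∀ {u} → u EndpointOf e → u ≡ first ⊎ u ≡ last
      first≺last  : first ≺ last
      first~last  : first ~ last
      src-⊓       : toℕ (src e) ≡ toℕ first ⊓ toℕ last
      tgt-⊔       : toℕ (tgt e) ≡ toℕ first ⊔ toℕ last

  orientation : ∀ e → Orientation e
  orientation e with compare σ (src e) (tgt e)
  ... | inj₁ s≺t = record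
    { first∈ = inj₁ refl ; last∈ = inj₂ refl ; only = λ u∈ → u∈
    ; first≺last = s≺t ; first~last = src~tgt e
    ; src-⊓ = sym (ℕ.m≤n⇒m⊓n≡m (ℕ.<⇒≤ (src<tgt e)))
    ; tgt-⊔ = sym (ℕ.m≤n⇒m⊔n≡n (ℕ.<⇒≤ (src<tgt e))) }
  ... | inj₂ (inj₁ s≡t) = ⊥-elim (ℕ.<-irrefl (cong toℕ s≡t) (src<tgt e))
  ... | inj₂ (inj₂ t≺s) = record
    { first∈ = inj₂ refl ; last∈ = inj₁ refl ; only = Sum.swap
    ; first≺last = t≺s ; first~last = ~-sym (src~tgt e)
    ; src-⊓ = sym (ℕ.m≥n⇒m⊓n≡n (ℕ.<⇒≤ (src<tgt e)))
    ; tgt-⊔ = sym (ℕ.m≥n⇒m⊔n≡m (ℕ.<⇒≤ (src<tgt e))) }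

  module Oriented (e : Edge G) = Orientation (orientation e)
  open Oriented using (first; last; first∈; last∈; only; first≺last; first~last)

  infix 4 _≼_
  _≼_ : Fin (order G) → Fin (order G) → Set
  u ≼ v = toℕ (position σ u) ≤ toℕ (position σ v)

  module _ (p₁-free : Free ⟦ G ⟧ p₁ σ) where

    -- Excluding `p₁` makes the reverse of σ a perfect elimination ordering: earlier neighbours of w
    -- form a clique. Closed neighbourhoods let u or v be w itself.
    near-below : ∀ {u v w} → u ≼ w → v ≼ w → Near u w → Near v w → Near u v
    near-below u≼w v≼w (inj₁ refl) vw = near-sym vw
    near-below u≼w v≼w (inj₂ uw) (inj₁ refl) = inj₂ uw
    near-below {u} {v} u≼w v≼w (inj₂ uw) (inj₂ vw)
      with ≤⇒≺⊎≡ σ u≼w | ≤⇒≺⊎≡ σ v≼w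
    ... | inj₂ refl | _ = ⊥-elim (~-irrefl uw)
    ... | inj₁ _ | inj₂ refl = ⊥-elim (~-irrefl vw)
    ... | inj₁ u≺w | inj₁ v≺w with near? u v | compare σ u v
    ... | yes n | _ = n
    ... | no ¬n | inj₁ u≺v = ⊥-elim (p₁-free u≺v v≺w (uw , vw , ¬n ∘ inj₂))
    ... | no ¬n | inj₂ (inj₁ u≡v) = inj₁ u≡v
    ... | no ¬n | inj₂ (inj₂ v≺u) =
      ⊥-elim (p₁-free v≺u u≺w (vw , uw , ¬n ∘ near-sym ∘ inj₂))

    -- In the subtree representation in which v occupies the nodes
    -- {v} ∪ {w ≻ v : w ~ v}, an edge occupies the union of two subtrees and
    -- has its root at its first endpoint; of two intersecting subtrees, one
    -- contains the root of the other.
    meets-first : ∀ e f → first e ≼ first f → Meets e f →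
      ∃[ u ] (u EndpointOf e × u ≼ first f × Near u (first f))
    meets-first e f a≼c (u , v , u∈e , v∈f , n) with only e u∈e | only f v∈f
    ... | p | q = go p q n
      where
      a = first e
      b = last e
      c = first f
      d = last f
      a≼b : a ≼ b
      a≼b = ℕ.<⇒≤ (first≺last e)
      c≼d : c ≼ d
      c≼d = ℕ.<⇒≤ (first≺last f)
      a≼d : a ≼ d
      a≼d = ℕ.≤-trans a≼c c≼d
      ab : Near a b
      ab = inj₂ (first~last e)
      cd : Near c d
      cd = inj₂ (first~last f)
      Result = ∃[ u ] (u EndpointOf e × u ≼ c × Near u c)
      via-a : Near a c → Result
      via-a n = a , first∈ e , a≼c , n
      via-b : Near b c → Result
      via-b n with ℕ.≤-total (toℕ (position σ b)) (toℕ (position σ c))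
      ... | inj₁ b≼c = b , last∈ e , b≼c , n
      ... | inj₂ c≼b = via-a (near-below a≼b c≼b ab (near-sym n))
      via-ad : Near a d → Result
      via-ad n = via-a (near-below a≼d c≼d n cd)
      go : u ≡ a ⊎ u ≡ b → v ≡ c ⊎ v ≡ d → Near u v → Result
      go (inj₁ refl) (inj₁ refl) n = via-a n
      go (inj₁ refl) (inj₂ refl) n = via-ad n
      go (inj₂ refl) (inj₁ refl) n = via-b n
      -- The later of b and d is near both the other one and the first endpoint of its own edge, all
      -- at or before it; `near-below` makes those two near, which moves the contact to an earlier
      -- vertex.
      go (inj₂ refl) (inj₂ refl) n
        with ℕ.≤-total (toℕ (position σ b)) (toℕ (position σ d))
      ... | inj₁ b≼d = via-b (near-below b≼d c≼d n cd)
      ... | inj₂ d≼b = via-ad (near-below a≼b d≼b ab (near-sym n))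

    -- The subtrees of e and f both contain the root of g. Their endpoints responsible for this lie
    -- at or before that root, so they are near each other.
    meets-below : ∀ {e f g} → first e ≼ first g → first f ≼ first g →
      Meets e g → Meets f g → Meets e f
    meets-below {e} {f} {g} e≼g f≼g eg fg
      with u , u∈e , u≼c , uc ← meets-first e g e≼g eg
         | v , v∈f , v≼c , vc ← meets-first f g f≼g fg =
      u , v , u∈e , v∈f , near-below u≼c v≼c uc vc

    module _ (p₄-free : Free ⟦ G ⟧ p₄ σ) where

      -- If uw were an edge and uv not, then vw would complete `p₁` as an edge and `p₄` as a
      -- non-edge. Thus the subtree of a vertex is an interval of σ starting at that vertex.
      near-between : ∀ {u v w} → u ≼ v → v ≼ w → Near u w → Near u v
      near-between {u} {v} {w} u≼v v≼w n with ≤⇒≺⊎≡ σ u≼v | ≤⇒≺⊎≡ σ v≼w | n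
      ... | inj₂ u≡v | _ | _ = inj₁ u≡v
      ... | inj₁ _ | inj₂ refl | _ = n
      ... | inj₁ u≺v | inj₁ v≺w | inj₁ refl = ⊥-elim (ℕ.<-asym u≺v v≺w)
      ... | inj₁ u≺v | inj₁ v≺w | inj₂ uw with u ~? v | v ~? w
      ... | yes uv | _ = inj₂ uv
      ... | no u≁v | yes vw = ⊥-elim (p₁-free u≺v v≺w (uw , vw , u≁v))
      ... | no u≁v | no v≁w = ⊥-elim (p₄-free u≺v v≺w (uw , u≁v , v≁w))

      -- Some endpoint u of e reaches as far as `first g`. Either `first f` lies between u and
      -- `first g`, or it lies between `first e` and u, a stretch covered by the interval of
      -- `first e`.
      meets-between : ∀ {e f g} → first e ≼ first f → first f ≼ first g →
        Meets e g → Meets e f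
      meets-between {e} {f} {g} e≼f f≼g eg
        with u , u∈e , u≼c , uc ← meets-first e g (ℕ.≤-trans e≼f f≼g) eg
        with ℕ.≤-total (toℕ (position σ u)) (toℕ (position σ (first f)))
      ... | inj₁ u≼f = u , first f , u∈e , first∈ f , near-between u≼f f≼g uc
      ... | inj₂ f≼u = first e , first f , first∈ e , first∈ f ,
        near-between e≼f f≼u (endpoints-near {e = e} (first∈ e) u∈e)

  module _ (p₄-free : Free ⟦ G ⟧ p₄ σ) where

    -- Were `first f` strictly inside e, it would form `p₄` with the two endpoints of e, being
    -- adjacent to neither.
    ¬meets⇒≺ : ∀ {e f} → first e ≼ first f → ¬ Meets e f →
      ∀ {u v} → u EndpointOf e → v EndpointOf f → u ≺ v
    ¬meets⇒≺ {e} {f} e≼f ¬ef {u} {v} u∈e v∈f = go (only e u∈e) (only f v∈f)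
      where
      ¬near : ∀ {u v} → u EndpointOf e → v EndpointOf f → ¬ Near u v
      ¬near u∈ v∈ n = ¬ef (_ , _ , u∈ , v∈ , n)
      a≺c : first e ≺ first f
      a≺c with ≤⇒≺⊎≡ σ e≼f
      ... | inj₁ a≺c = a≺c
      ... | inj₂ a≡c = ⊥-elim (¬near (first∈ e) (first∈ f) (inj₁ a≡c))
      b≺c : last e ≺ first f
      b≺c with compare σ (last e) (first f)
      ... | inj₁ b≺c = b≺c
      ... | inj₂ (inj₁ b≡c) = ⊥-elim (¬near (last∈ e) (first∈ f) (inj₁ b≡c))
      ... | inj₂ (inj₂ c≺b) = ⊥-elim (p₄-free a≺c c≺b
        ( first~last e
        , ¬near (first∈ e) (first∈ f) ∘ inj₂
        , ¬near (last∈ e) (first∈ f) ∘ near-sym ∘ inj₂ ))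
      go : u ≡ first e ⊎ u ≡ last e → v ≡ first f ⊎ v ≡ last f → u ≺ v
      go (inj₁ refl) (inj₁ refl) = a≺c
      go (inj₁ refl) (inj₂ refl) = ℕ.<-trans a≺c (first≺last f)
      go (inj₂ refl) (inj₁ refl) = b≺c
      go (inj₂ refl) (inj₂ refl) = ℕ.<-trans b≺c (first≺last f)

    -- The vertex `first f` lies strictly after e and strictly before g, adjacent to no endpoint
    -- involved. Hence a contact between e and g cannot be a common vertex, and as an edge it would
    -- span a `p₄` over `first f`. This is transitivity of forward non-adjacency.
    ¬meets-trans : ∀ {e f g} → first e ≼ first f → first f ≼ first g →
      ¬ Meets e f → ¬ Meets f g → ¬ Meets e g
    ¬meets-trans {e} {f} {g} e≼f f≼g ¬ef ¬fg (u , w , u∈e , w∈g , n)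
      with ¬meets⇒≺ {e} {f} e≼f ¬ef u∈e (first∈ f)
         | ¬meets⇒≺ {f} {g} f≼g ¬fg (first∈ f) w∈g
    ... | u≺v | v≺w with n
    ... | inj₁ refl = ℕ.<-asym u≺v v≺w
    ... | inj₂ uw = p₄-free u≺v v≺w
      ( uw
      , (λ uv → ¬ef (u , first f , u∈e , first∈ f , inj₂ uv))
      , (λ vw → ¬fg (first f , w , first∈ f , w∈g , inj₂ vw)) )

  -- Unless they share an endpoint, one of the two edges lies wholly before some endpoint of the
  -- other; avoiding `p₂` forces that endpoint to be adjacent to it.
  p₂-free⇒meets : Free ⟦ G ⟧ p₂ σ → ∀ e f → Meets e f
  p₂-free⇒meets p₂-free e f = [ go e f , meets-sym {f} {e} ∘ go f e ]′
    (ℕ.≤-total (toℕ (position σ (first e))) (toℕ (position σ (first f))))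
    where
    extend : ∀ {u v w} → u ≺ v → v ≺ w → u ~ v → Near u w ⊎ Near v w
    extend {u} {v} {w} u≺v v≺w uv with u ~? w | v ~? w
    ... | yes uw | _ = inj₁ (inj₂ uw)
    ... | no _ | yes vw = inj₂ (inj₂ vw)
    ... | no u≁w | no v≁w = ⊥-elim (p₂-free u≺v v≺w (uv , u≁w , v≁w))
    go : ∀ e f → first e ≼ first f → Meets e f
    go e f a≼c with compare σ (last e) (first f) | compare σ (last e) (last f)
    ... | inj₁ b≺c | _ with extend (first≺last e) b≺c (first~last e)
    ...   | inj₁ ac = _ , _ , first∈ e , first∈ f , ac
    ...   | inj₂ bc = _ , _ , last∈ e , first∈ f , bc
    go e f a≼c | inj₂ (inj₁ b≡c) | _ = _ , _ , last∈ e , first∈ f , inj₁ b≡c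
    go e f a≼c | inj₂ (inj₂ c≺b) | inj₁ b≺d
      with extend (first≺last e) b≺d (first~last e)
    ...   | inj₁ ad = _ , _ , first∈ e , last∈ f , ad
    ...   | inj₂ bd = _ , _ , last∈ e , last∈ f , bd
    go e f a≼c | inj₂ (inj₂ c≺b) | inj₂ (inj₁ b≡d) =
      _ , _ , last∈ e , last∈ f , inj₁ b≡d
    go e f a≼c | inj₂ (inj₂ c≺b) | inj₂ (inj₂ d≺b)
      with extend (first≺last f) d≺b (first~last f)
    ...   | inj₁ cb = _ , _ , last∈ e , first∈ f , near-sym cb
    ...   | inj₂ db = _ , _ , last∈ e , last∈ f , near-sym db

  -- The mirror image of the previous argument: reversing an ordering exchanges `p₂` and `p₃`.
  p₃-free⇒meets : Free ⟦ G ⟧ p₃ σ → ∀ e f → Meets e f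
  p₃-free⇒meets p₃-free e f = [ meets-sym {f} {e} ∘ go f e , go e f ]′
    (ℕ.≤-total (toℕ (position σ (last e))) (toℕ (position σ (last f))))
    where
    extend : ∀ {u v w} → u ≺ v → v ≺ w → v ~ w → Near v u ⊎ Near w u
    extend {u} {v} {w} u≺v v≺w vw with u ~? v | u ~? w
    ... | yes uv | _ = inj₁ (near-sym (inj₂ uv))
    ... | no _ | yes uw = inj₂ (near-sym (inj₂ uw))
    ... | no u≁v | no u≁w = ⊥-elim (p₃-free u≺v v≺w (vw , u≁v , u≁w))
    go : ∀ e f → last f ≼ last e → Meets e f
    go e f d≼b with compare σ (last f) (first e) | compare σ (first f) (first e)
    ... | inj₁ d≺a | _ with extend d≺a (first≺last e) (first~last e)
    ...   | inj₁ ad = _ , _ , first∈ e , last∈ f , ad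
    ...   | inj₂ bd = _ , _ , last∈ e , last∈ f , bd
    go e f d≼b | inj₂ (inj₁ d≡a) | _ = _ , _ , first∈ e , last∈ f , inj₁ (sym d≡a)
    go e f d≼b | inj₂ (inj₂ a≺d) | inj₁ c≺a
      with extend c≺a (first≺last e) (first~last e)
    ...   | inj₁ ac = _ , _ , first∈ e , first∈ f , ac
    ...   | inj₂ bc = _ , _ , last∈ e , first∈ f , bc
    go e f d≼b | inj₂ (inj₂ a≺d) | inj₂ (inj₁ c≡a) =
      _ , _ , first∈ e , first∈ f , inj₁ (sym c≡a)
    go e f d≼b | inj₂ (inj₂ a≺d) | inj₂ (inj₂ a≺c)
      with extend a≺c (first≺last f) (first~last f)
    ...   | inj₁ ca = _ , _ , first∈ e , first∈ f , near-sym ca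
    ...   | inj₂ da = _ , _ , first∈ e , last∈ f , near-sym da

-- Pattern-free orderings of `L² G`

Complete : Graph → Set
Complete H = ∀ x y → x ≢ y → Graph._~_ H x y

-- Every one of the four patterns contains a non-edge.
complete-free : ∀ {H} (τ : Ordering (Vertex H)) → Complete H → ∀ p → Free H p τ
complete-free τ K p₁ x≺y y≺z (_ , _ , x≁y) = x≁y (K _ _ (≺⇒≢ τ x≺y))
complete-free τ K p₂ x≺y y≺z (_ , _ , y≁z) = y≁z (K _ _ (≺⇒≢ τ y≺z))
complete-free τ K p₃ x≺y y≺z (_ , x≁y , _) = x≁y (K _ _ (≺⇒≢ τ x≺y))
complete-free τ K p₄ x≺y y≺z (_ , x≁y , _) = x≁y (K _ _ (≺⇒≢ τ x≺y))

module _ {G : AdjacencyLists} {σ : Ordering (Fin (order G))} where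
  open Adjacency G

  meets⇒complete : (∀ e f → Meets e f) → Complete (L² G)
  meets⇒complete m e f e≢f = meets⇒adjacent e≢f (m e f)

  complete-threshold : PatternFree threshold ⟦ G ⟧ σ → Complete (L² G)
  complete-threshold free = meets⇒complete (p₂-free⇒meets G σ (free (there (here refl))))

  complete-split : PatternFree split ⟦ G ⟧ σ → Complete (L² G)
  complete-split free = meets⇒complete (p₃-free⇒meets G σ (free (there (here refl))))

  module _ (τ : Ordering (Edge G))
    (mono : ∀ {e f} → Ordering._≺_ τ e f →
            _≼_ G σ (Oriented.first G σ e) (Oriented.first G σ f)) where

    L²-p₁-free : Free ⟦ G ⟧ p₁ σ → Free (L² G) p₁ τ
    L²-p₁-free free {e} {f} {g} e≺f f≺g (eg , fg , e≁f) = e≁f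
      (meets⇒adjacent (≺⇒≢ τ e≺f)
        (meets-below G σ free {e} {f} {g} (ℕ.≤-trans (mono e≺f) (mono f≺g)) (mono f≺g)
          (adjacent⇒meets eg) (adjacent⇒meets fg)))

    PatternFree-L² : ∀ 𝒢 → PatternFree 𝒢 ⟦ G ⟧ σ → PatternFree 𝒢 (L² G) τ
    PatternFree-L² threshold free {p} _ = complete-free {L² G} τ (complete-threshold free) p
    PatternFree-L² interval free (here refl) = L²-p₁-free (free (here refl))
    PatternFree-L² interval free (there (here refl)) {e} {f} {g} e≺f f≺g (eg , e≁f , _) =
      e≁f (meets⇒adjacent (≺⇒≢ τ e≺f)
        (meets-between G σ (free (here refl)) (free (there (here refl))) {e} {f} {g}
          (mono e≺f) (mono f≺g) (adjacent⇒meets eg)))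
    PatternFree-L² split free {p} _ = complete-free {L² G} τ (complete-split free) p
    PatternFree-L² cocomparability free (here refl) {e} {f} {g} e≺f f≺g (eg , e≁f , f≁g) =
      ¬meets-trans G σ (free (here refl)) {e} {f} {g} (mono e≺f) (mono f≺g)
        (e≁f ∘ meets⇒adjacent (≺⇒≢ τ e≺f)) (f≁g ∘ meets⇒adjacent (≺⇒≢ τ f≺g))
        (adjacent⇒meets eg)
    PatternFree-L² chordal free (here refl) = L²-p₁-free (free (here refl))

-- Membership in the classes

module _ {H : Graph} where
  open Graph H

  complete⇒Threshold : Complete H → Threshold H
  complete⇒Threshold K = (λ _ → ℚ.1ℚ) , ℚ.0ℚ , λ x y x≢y →
    mk⇔ (λ _ → toWitness {a? = ℚ.0ℚ ℚ.<? ℚ.1ℚ ℚ.+ ℚ.1ℚ} _) (λ _ → K x y x≢y)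

  complete⇒Split : Complete H → Split H
  complete⇒Split K = (λ _ → true) , (λ x y _ _ → K x y) , λ _ _ ()

  -- Non-edges are oriented forward along τ; a failure of transitivity is precisely a `p₄`.
  p₄-free⇒cocomparability : (τ : Ordering (Vertex H)) → Free H p₄ τ →
    Comparability (complement H)
  p₄-free⇒cocomparability τ free = (λ x y → x ≺ y × ¬ (x ~ y))
    , (λ x y → mk⇔ (to x y) from)
    , (λ x y (x≺y , _) (y≺x , _) → ℕ.<-asym x≺y y≺x)
    , (λ x y z (x≺y , x≁y) (y≺z , y≁z) →
        ℕ.<-trans x≺y y≺z , λ xz → free x≺y y≺z (xz , x≁y , y≁z))
    where
    open Ordering τ using (_≺_)
    to : ∀ x y → x ≢ y × ¬ (x ~ y) → x ≺ y × ¬ (x ~ y) ⊎ y ≺ x × ¬ (y ~ x)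
    to x y (x≢y , x≁y) with compare τ x y
    ... | inj₁ x≺y = inj₁ (x≺y , x≁y)
    ... | inj₂ (inj₁ x≡y) = ⊥-elim (x≢y x≡y)
    ... | inj₂ (inj₂ y≺x) = inj₂ (y≺x , x≁y ∘ ~-sym)
    from : ∀ {x y} → x ≺ y × ¬ (x ~ y) ⊎ y ≺ x × ¬ (y ~ x) → x ≢ y × ¬ (x ~ y)
    from (inj₁ (x≺y , x≁y)) = ≺⇒≢ τ x≺y , x≁y
    from (inj₂ (y≺x , y≁x)) = ≺⇒≢ τ y≺x ∘ sym , y≁x ∘ ~-sym

argmax : ∀ {k n} (f : Fin (suc k) → Fin n) → ∃[ i ] (∀ j → toℕ (f j) ≤ toℕ (f i))
argmax {0} f = fzero , λ { fzero → ℕ.≤-refl }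
argmax {suc k} f with argmax (f ∘ fsuc)
... | i , max with ℕ.≤-total (toℕ (f fzero)) (toℕ (f (fsuc i)))
... | inj₁ ≤i = fsuc i , λ { fzero → ≤i ; (fsuc j) → max j }
... | inj₂ i≤ = fzero , λ { fzero → ℕ.≤-refl ; (fsuc j) → ℕ.≤-trans (max j) i≤ }

-- Makes an edge between the two cycle neighbours of i count as a chord. The coincidences that are
-- not absurd outright would force k to be 1, 2 or 3, which `small` refutes.
cyclic-neighbours : ∀ {k} → 4 ≤ k → {h i j : Fin k} → Successive h i → Successive i j →
  h ≢ j × ¬ Successive h j × ¬ Successive j h
cyclic-neighbours {k} 4≤k hi ij = let p , q , r = go hi ij in p ∘ cong toℕ , q , r
  where
  _⟶_ : ℕ → ℕ → Set
  a ⟶ b = b ≡ suc a ⊎ (suc a ≡ k × b ≡ 0)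
  small : ∀ {m} {A : Set} → m ≡ k → {m<4 : True (m ℕ.<? 4)} → A
  small refl {m<4} = ⊥-elim (ℕ.<⇒≱ (toWitness m<4) 4≤k)
  go : ∀ {a b c} → a ⟶ b → b ⟶ c → a ≢ c × ¬ (a ⟶ c) × ¬ (c ⟶ a)
  go (inj₁ refl) (inj₁ refl) = (λ ())
    , (λ { (inj₁ ()) ; (inj₂ (_ , ())) })
    , (λ { (inj₁ ()) ; (inj₂ (3≡k , refl)) → small 3≡k })
  go (inj₁ refl) (inj₂ (2+a≡k , refl)) = (λ { refl → small 2+a≡k })
    , (λ { (inj₁ ()) ; (inj₂ (1+a≡k , _)) → ℕ.1+n≢n (trans 2+a≡k (sym 1+a≡k)) })
    , (λ { (inj₁ refl) → small 2+a≡k ; (inj₂ (1≡k , _)) → small 1≡k })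
  go (inj₂ (1+a≡k , refl)) (inj₁ refl) = (λ { refl → small 1+a≡k })
    , (λ { (inj₁ refl) → small 1+a≡k ; (inj₂ (_ , ())) })
    , (λ { (inj₁ refl) → small 1+a≡k ; (inj₂ (2≡k , _)) → small 2≡k })
  go (inj₂ (_ , refl)) (inj₂ (1≡k , _)) = small 1≡k

successor : ∀ {k} (i : Fin k) → ∃[ j ] Successive i j
successor {suc k} i with suc (toℕ i) ℕ.<? suc k
... | yes 1+i<k = fromℕ< 1+i<k , inj₁ (Fin.toℕ-fromℕ< 1+i<k)
... | no 1+i≮k = fzero , inj₂ (ℕ.≤-antisym (Fin.toℕ<n i) (ℕ.≮⇒≥ 1+i≮k) , refl)

predecessor : ∀ {k} (i : Fin k) → ∃[ h ] Successive h i
predecessor {suc k} fzero = fromℕ k , inj₂ (cong suc (Fin.toℕ-fromℕ k) , refl)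
predecessor (fsuc i) = inject₁ i , inj₁ (cong suc (sym (Fin.toℕ-inject₁ i)))

module _ {H : Graph} where
  open Graph H

  -- Both cycle neighbours of the τ-latest vertex of the cycle precede it, so avoiding `p₁` joins
  -- them by a chord. Decidable adjacency turns the excluded non-edge into an edge.
  p₁-free⇒chordal : (∀ x y → Dec (x ~ y)) → (τ : Ordering (Vertex H)) →
    Free H p₁ τ → Chordal H
  p₁-free⇒chordal adj? τ free (suc k) c 4≤k c-inj c-cycle
    with i , max ← argmax (position τ ∘ c)
    with h , hi ← predecessor i | j , ij ← successor i
    with h≢j , ¬hj , ¬jh ← cyclic-neighbours 4≤k {h} {i} {j} hi ij =
    h , j , ¬hj , ¬jh , chord
    where
    open Ordering τ using (_≺_)
    hi~ : c h ~ c i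
    hi~ = c-cycle h i hi
    ji~ : c j ~ c i
    ji~ = ~-sym (c-cycle i j ij)
    below : ∀ {l} → c l ~ c i → c l ≺ c i
    below {l} li with ≤⇒≺⊎≡ τ (max l)
    ... | inj₁ l≺i = l≺i
    ... | inj₂ l≡i = ⊥-elim (~-irrefl (subst (_~ c i) l≡i li))
    chord : c h ~ c j
    chord with adj? (c h) (c j) | compare τ (c h) (c j)
    ... | yes hj | _ = hj
    ... | no h≁j | inj₁ h≺j = ⊥-elim (free h≺j (below ji~) (hi~ , ji~ , h≁j))
    ... | no h≁j | inj₂ (inj₁ ch≡cj) = ⊥-elim (h≢j (c-inj ch≡cj))
    ... | no h≁j | inj₂ (inj₂ j≺h) =
      ⊥-elim (free j≺h (below hi~) (ji~ , hi~ , h≁j ∘ ~-sym))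

-- An edge is represented by the union of the intervals of its endpoints.
L²-interval : ∀ {G} → Interval ⟦ G ⟧ → Interval (L² G)
L²-interval {G} (l , r , l≤r , ~⇔) = lᴱ , rᴱ , lᴱ≤rᴱ , λ e f e≢f →
  mk⇔ (meets⇒intersect {e} {f} ∘ Adjacency.adjacent⇒meets G)
      (λ (p , q) → Adjacency.meets⇒adjacent G e≢f (intersect⇒meets {e} {f} p q))
  where
  open Adjacency G
  lᴱ rᴱ : Edge G → ℚ
  lᴱ e = l (src e) ℚ.⊓ l (tgt e)
  rᴱ e = r (src e) ℚ.⊔ r (tgt e)

  lᴱ≤ : ∀ {e u} → u EndpointOf e → lᴱ e ℚ.≤ l u
  lᴱ≤ (inj₁ refl) = ℚ.p⊓q≤p _ _
  lᴱ≤ {e} (inj₂ refl) = ℚ.p⊓q≤q (l (src e)) _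

  ≤rᴱ : ∀ {e u} → u EndpointOf e → r u ℚ.≤ rᴱ e
  ≤rᴱ (inj₁ refl) = ℚ.p≤p⊔q _ _
  ≤rᴱ {e} (inj₂ refl) = ℚ.p≤q⊔p (r (src e)) _

  lᴱ-attained : ∀ e → ∃[ u ] (u EndpointOf e × lᴱ e ≡ l u)
  lᴱ-attained e with ℚ.⊓-sel (l (src e)) (l (tgt e))
  ... | inj₁ eq = _ , inj₁ refl , eq
  ... | inj₂ eq = _ , inj₂ refl , eq

  rᴱ-attained : ∀ e → ∃[ u ] (u EndpointOf e × rᴱ e ≡ r u)
  rᴱ-attained e with ℚ.⊔-sel (r (src e)) (r (tgt e))
  ... | inj₁ eq = _ , inj₁ refl , eq
  ... | inj₂ eq = _ , inj₂ refl , eq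

  lᴱ≤rᴱ : ∀ e → lᴱ e ℚ.≤ rᴱ e
  lᴱ≤rᴱ e = ℚ.≤-trans (lᴱ≤ {e} (inj₁ refl))
    (ℚ.≤-trans (l≤r (src e)) (≤rᴱ {e} (inj₁ refl)))

  near⇒l≤r : ∀ {u v} → Near u v → l u ℚ.≤ r v
  near⇒l≤r (inj₁ refl) = l≤r _
  near⇒l≤r {u} {v} (inj₂ uv) = proj₁ (Equivalence.to (~⇔ u v u≢v) uv)
    where
    u≢v : u ≢ v
    u≢v refl = Graph.~-irrefl ⟦ G ⟧ uv

  intersect⇒near : ∀ {u v} → l u ℚ.≤ r v → l v ℚ.≤ r u → Near u v
  intersect⇒near {u} {v} p q with u Fin.≟ v
  ... | yes u≡v = inj₁ u≡v
  ... | no u≢v = inj₂ (Equivalence.from (~⇔ u v u≢v) (p , q))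

  meets⇒intersect : ∀ {e f} → Meets e f → lᴱ e ℚ.≤ rᴱ f × lᴱ f ℚ.≤ rᴱ e
  meets⇒intersect {e} {f} (u , v , u∈e , v∈f , n) =
    ℚ.≤-trans (lᴱ≤ {e} u∈e) (ℚ.≤-trans (near⇒l≤r n) (≤rᴱ {f} v∈f)) ,
    ℚ.≤-trans (lᴱ≤ {f} v∈f) (ℚ.≤-trans (near⇒l≤r (near-sym n)) (≤rᴱ {e} u∈e))

  -- If r a < l c, then l b ≤ r a < l c ≤ r d, so b and d intersect.
  intersect⇒meets : ∀ {e f} → lᴱ e ℚ.≤ rᴱ f → lᴱ f ℚ.≤ rᴱ e → Meets e f
  intersect⇒meets {e} {f} le≤rf lf≤re
    with a , a∈e , la ← lᴱ-attained e | b , b∈e , rb ← rᴱ-attained e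
       | c , c∈f , rc ← rᴱ-attained f | d , d∈f , ld ← lᴱ-attained f
    with ℚ.≤-total (l c) (r a)
  ... | inj₁ lc≤ra = a , c , a∈e , c∈f ,
    intersect⇒near (subst₂ ℚ._≤_ la rc le≤rf) lc≤ra
  ... | inj₂ ra≤lc = b , d , b∈e , d∈f , intersect⇒near
    (ℚ.≤-trans (near⇒l≤r (endpoints-near {e = e} b∈e a∈e))
      (ℚ.≤-trans ra≤lc (near⇒l≤r (endpoints-near {e = f} c∈f d∈f))))
    (subst₂ ℚ._≤_ ld rb lf≤re)

L²-∈Class : ∀ 𝒢 {G σ} → ⟦ G ⟧ ∈Class 𝒢 → PatternFree 𝒢 ⟦ G ⟧ σ →
  (τ : Ordering (Edge G)) → PatternFree 𝒢 (L² G) τ → L² G ∈Class 𝒢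
L²-∈Class threshold {G} {σ} _ free τ _ =
  lift (complete⇒Threshold {L² G} (complete-threshold {G} {σ} free))
L²-∈Class interval {G} (lift i) _ _ _ = lift (L²-interval {G} i)
L²-∈Class split {G} {σ} _ free τ _ =
  lift (complete⇒Split {L² G} (complete-split {G} {σ} free))
L²-∈Class cocomparability {G} _ _ τ free =
  p₄-free⇒cocomparability {L² G} τ (free (here refl))
L²-∈Class chordal {G} _ _ τ free =
  lift (p₁-free⇒chordal {L² G} (Adjacency.adjacent? G) τ (free (here refl)))

-- Enumerating the edges

module _ {A : Set} where

  allPairs-lookup : {R : Rel A 0ℓ} {xs : List A} → AllPairs R xs →
    ∀ {i j} → i <ᶠ j → R (lookup xs i) (lookup xs j)
  allPairs-lookup (Rx ∷ _) {fzero} {fsuc j} _ = All.lookup Rx (∈-lookup j)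
  allPairs-lookup (_ ∷ R) {fsuc i} {fsuc j} (s≤s i<j) = allPairs-lookup R i<j

  unique-lookup-injective : {xs : List A} → Unique xs → Injective _≡_ _≡_ (lookup xs)
  unique-lookup-injective xs! {i} {j} eq with Fin.<-cmp i j
  ... | tri< i<j _ _ = ⊥-elim (allPairs-lookup xs! i<j eq)
  ... | tri≈ _ i≡j _ = i≡j
  ... | tri> _ _ j<i = ⊥-elim (allPairs-lookup xs! j<i (sym eq))

  ⊆-length : {xs ys : List A} → Unique xs → (∀ {x} → x ∈ xs → x ∈ ys) →
    length xs ≤ length ys
  ⊆-length {xs} {ys} xs! sub = Fin.injective⇒≤ {f = λ i → index (sub (∈-lookup i))}
    λ {i} {j} eq → unique-lookup-injective xs!
      (trans (lookup-index (sub (∈-lookup i)))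
        (trans (cong (lookup ys) eq) (sym (lookup-index (sub (∈-lookup j))))))

  -- Loop invariants describe progress by splitting a list at the current element; this converts
  -- such a split into an index.
  tabulate-split : ∀ {n} (f : Fin n → A) {xs y zs} → xs ++ y ∷ zs ≡ tabulate f →
    ∃[ i ] (f i ≡ y × toℕ i ≡ length xs)
  tabulate-split {suc n} f {[]} refl = fzero , refl , refl
  tabulate-split {suc n} f {x ∷ xs} eq
    with i , fi , len ← tabulate-split (f ∘ fsuc) {xs} (List.∷-injectiveʳ eq) =
    fsuc i , fi , cong suc len

  listOrdering : {X : Set} (f : X → A) → Injective _≡_ _≡_ f →
    (xs : List A) → Unique xs → (∀ x → f x ∈ xs) → (∀ {a} → a ∈ xs → ∃[ x ] f x ≡ a) →
    Ordering X
  listOrdering f f-inj xs xs! f∈ f-onto = record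
    { size = length xs
    ; bijection = mk⤖ {to = pos} (pos-inj , λ i → let x , fx = f-onto (∈-lookup i) in
        x , λ { refl → unique-lookup-injective xs! (trans (sym (lookup-index (f∈ x))) fx) }) }
    where
    pos = λ x → index (f∈ x)
    pos-inj : Injective _≡_ _≡_ pos
    pos-inj {x} {y} eq = f-inj (trans (lookup-index (f∈ x))
      (trans (cong (lookup xs) eq) (sym (lookup-index (f∈ y)))))

allFin-split : ∀ {n} {xs zs} {v : Fin n} → xs ++ v ∷ zs ≡ allFin n → toℕ v ≡ length xs
allFin-split eq with _ , refl , len ← tabulate-split _ eq = len

module Enumeration (G : AdjacencyLists) (σ : Ordering (Fin (order G))) where
  open Graph ⟦ G ⟧
  open Adjacency G
  open Ordering σ using (_≺_)
  open Oriented G σ using (first; last; first≺last; first~last; src-⊓; tgt-⊔)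

  Dart : Set
  Dart = Fin (order G) × Fin (order G)

  vertexAt : Fin (size σ) → Fin (order G)
  vertexAt i = proj₁ (Bijection.surjective (Ordering.bijection σ) i)

  position-vertexAt : ∀ i → position σ (vertexAt i) ≡ i
  position-vertexAt i = proj₂ (Bijection.surjective (Ordering.bijection σ) i) refl

  vertexAt-position : ∀ v → vertexAt (position σ v) ≡ v
  vertexAt-position v = position-injective σ (position-vertexAt _)

  size≡order : size σ ≡ order G
  size≡order = ℕ.≤-antisym
    (Fin.injective⇒≤ {f = vertexAt} λ {i} {j} eq →
      trans (sym (position-vertexAt i)) (trans (cong (position σ) eq) (position-vertexAt j)))
    (Fin.injective⇒≤ {f = position σ} (position-injective σ))

  sorted : List (Fin (order G))
  sorted = tabulate vertexAt

  length-sorted : length sorted ≡ order G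
  length-sorted = trans (List.length-tabulate vertexAt) size≡order

  sorted-split : ∀ {us v ws} → us ++ v ∷ ws ≡ sorted → toℕ (position σ v) ≡ length us
  sorted-split eq with i , refl , len ← tabulate-split _ eq =
    trans (cong toℕ (position-vertexAt i)) len

  ∈-sorted : ∀ v → v ∈ sorted
  ∈-sorted v = subst (_∈ sorted) (vertexAt-position v) (∈-tabulate⁺ (position σ v))

  dartsFrom : Fin (order G) → List (Fin (order G)) → List Dart
  dartsFrom v = map (v ,_)

  -- On `sorted` this is exactly the sequence in which the program reads adjacency cells, with both
  -- directions of every edge, so filtering it reproduces the output order.
  darts : List (Fin (order G)) → List Dart
  darts = concatMap (λ v → dartsFrom v (nbrs G v))

  darts-∷ʳ : ∀ us v → darts (us ∷ʳ v) ≡ darts us ++ dartsFrom v (nbrs G v)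
  darts-∷ʳ us v = trans (List.concatMap-++ _ us [ v ])
    (cong (darts us ++_) (List.++-identityʳ _))

  ∈-darts : ∀ {u v} → u ~ v → (u , v) ∈ darts sorted
  ∈-darts {u} uv = ∈-concat⁺′ (∈-map⁺ (u ,_) uv) (∈-map⁺ _ (∈-sorted u))

  darts-adjacent : ∀ {u v} us → (u , v) ∈ darts us → u ~ v
  darts-adjacent us d∈ with _ , d∈w , w∈ ← ∈-concat⁻′ (map _ us) d∈
    with _ , _ , refl ← ∈-map⁻ _ w∈
    with _ , v∈ , refl ← ∈-map⁻ _ d∈w = v∈

  Forward : Dart → Set
  Forward (u , v) = u ≺ v

  forward? : ∀ d → Dec (Forward d)
  forward? (u , v) = position σ u Fin.<? position σ v

  edges : List Dart
  edges = filter forward? (darts sorted)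

  -- Darts from one vertex are tied and keep the order of its adjacency list, so only distinctness
  -- is asked besides `≼`. One sortedness proof then yields both uniqueness and monotonicity.
  Before : Dart → Dart → Set
  Before (u , v) (u′ , v′) = _≼_ G σ u u′ × (u , v) ≢ (u′ , v′)

  darts-sorted : AllPairs Before (darts sorted)
  darts-sorted = AllPairs.concat⁺
    (All.map⁺ (All.universal (λ v → AllPairs.map⁺ (AllPairs.map
      (λ u≢w → ℕ.≤-refl , u≢w ∘ cong proj₂) (AdjacencyLists.unique G v))) sorted))
    (AllPairs.map⁺ (AllPairs.map
      (λ {u} {v} u≺v → All.map⁺ (All.universal (λ _ → All.map⁺ (All.universal
        (λ _ → ℕ.<⇒≤ u≺v , ≺⇒≢ σ u≺v ∘ cong proj₁) (nbrs G v))) (nbrs G u)))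
      (AllPairs.tabulate⁺-< λ {i} {j} i<j →
        subst₂ _<ᶠ_ (sym (position-vertexAt i)) (sym (position-vertexAt j)) i<j)))

  edges-sorted : AllPairs Before edges
  edges-sorted = AllPairs.filter⁺ forward? darts-sorted

  edges-unique : Unique edges
  edges-unique = AllPairs.map proj₂ edges-sorted

  dart : Edge G → Dart
  dart e = first e , last e

  low high : Dart → ℕ
  low (u , v) = toℕ u ⊓ toℕ v
  high (u , v) = toℕ u ⊔ toℕ v

  dart-injective : Injective _≡_ _≡_ dart
  dart-injective {e} {f} eq = edge-≡
    (Fin.toℕ-injective (trans (src-⊓ e) (trans (cong low eq) (sym (src-⊓ f)))))
    (Fin.toℕ-injective (trans (tgt-⊔ e) (trans (cong high eq) (sym (tgt-⊔ f)))))

  dart∈edges : ∀ e → dart e ∈ edges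
  dart∈edges e = ∈-filter⁺ forward? (∈-darts (first~last e)) (first≺last e)

  edges-darts : ∀ {d} → d ∈ edges → ∃[ e ] dart e ≡ d
  edges-darts {u , v} d∈ with d∈darts , u≺v ← ∈-filter⁻ forward? {xs = darts sorted} d∈
    with e , u∈e , v∈e ← edgeBetween (darts-adjacent sorted d∈darts)
    with Oriented.only G σ e u∈e | Oriented.only G σ e v∈e
  ... | inj₁ refl | inj₁ refl = ⊥-elim (ℕ.<-irrefl refl u≺v)
  ... | inj₁ refl | inj₂ refl = e , refl
  ... | inj₂ refl | inj₁ refl = ⊥-elim (ℕ.<-asym u≺v (first≺last e))
  ... | inj₂ refl | inj₂ refl = ⊥-elim (ℕ.<-irrefl refl u≺v)

  edgeOrdering : Ordering (Edge G)
  edgeOrdering = listOrdering dart dart-injective edges edges-unique dart∈edges edges-darts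

  lookup-edges : ∀ e → lookup edges (position edgeOrdering e) ≡ dart e
  lookup-edges e = sym (lookup-index (dart∈edges e))

  edgeOrdering-mono : ∀ {e f} → Ordering._≺_ edgeOrdering e f → _≼_ G σ (first e) (first f)
  edgeOrdering-mono {e} {f} e≺f = subst₂ (_≼_ G σ)
    (cong proj₁ (lookup-edges e)) (cong proj₁ (lookup-edges f))
    (proj₁ (allPairs-lookup edges-sorted e≺f))

  -- Every dart or its reverse is forward.
  handshake : length (darts sorted) ≤ length edges + length edges
  handshake = subst (length (darts sorted) ≤_)
    (trans (List.length-++ edges) (cong (length edges +_) (List.length-map swap edges)))
    (⊆-length (AllPairs.map proj₂ darts-sorted) covered)
    where
    covered : ∀ {d} → d ∈ darts sorted → d ∈ edges ++ map swap edges
    covered {u , v} d∈ with compare σ u v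
    ... | inj₁ u≺v = ∈-++⁺ˡ (∈-filter⁺ forward? d∈ u≺v)
    ... | inj₂ (inj₁ refl) = ⊥-elim (~-irrefl (darts-adjacent sorted d∈))
    ... | inj₂ (inj₂ v≺u) = ∈-++⁺ʳ edges (∈-map⁺ swap
      (∈-filter⁺ forward? (∈-darts (~-sym (darts-adjacent sorted d∈))) v≺u))

-- Memory cells and running times

cells-++ : ∀ as {b bs} → cells (as ++ b ∷ bs) (length as) ≡ b
cells-++ [] = refl
cells-++ (a ∷ as) = cells-++ as

cells-map-lookup : ∀ {A : Set} (f : A → ℕ) xs i → cells (map f xs) (toℕ i) ≡ f (lookup xs i)
cells-map-lookup f (x ∷ xs) fzero = refl
cells-map-lookup f (x ∷ xs) (fsuc i) = cells-map-lookup f xs i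

cells-∷ʳ-other : ∀ as {a i} → length as ≢ i → cells (as ∷ʳ a) i ≡ cells as i
cells-∷ʳ-other [] {i = zero} 0≢i = ⊥-elim (0≢i refl)
cells-∷ʳ-other [] {i = suc i} _ = refl
cells-∷ʳ-other (b ∷ as) {i = zero} _ = refl
cells-∷ʳ-other (b ∷ as) {i = suc i} ≢i = cells-∷ʳ-other as (≢i ∘ cong suc)

-- `cells` is 0 past the end, like untouched memory, so appending an entry is a single write.
update-∷ʳ : ∀ {f : ℕ → ℕ} as {n a} → n ≡ length as → (∀ i → f i ≡ cells as i) →
  ∀ i → update f n a i ≡ cells (as ∷ʳ a) i
update-∷ʳ as refl f≗ i with length as ≟ i
... | yes refl = sym (cells-++ as)
... | no ≢i = trans (f≗ i) (sym (cells-∷ʳ-other as ≢i))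

update-same : ∀ {A : Set} (f : ℕ → A) i {a} → update f i a i ≡ a
update-same f i with i ≟ i
... | yes _ = refl
... | no i≢i = ⊥-elim (i≢i refl)

update-other : ∀ {A : Set} (f : ℕ → A) {i j a} → i ≢ j → update f i a j ≡ f j
update-other f {i} {j} i≢j with i ≟ j
... | yes i≡j = ⊥-elim (i≢j i≡j)
... | no _ = refl

-- The initial value e is arbitrary because `scanl` changes it along the induction.
cells-offset : ∀ xss {ys : List ℕ} {zss} e →
  cells (scanl _+_ e (map length (xss ++ ys ∷ zss))) (length xss) ≡ e + length (concat xss)
cells-offset [] e = sym (ℕ.+-identityʳ e)
cells-offset (xs ∷ xss) e = trans (cells-offset xss (e + length xs))
  (trans (ℕ.+-assoc e _ _) (cong (e +_) (sym (List.length-++ xs))))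

cells-next-offset : ∀ xss {ys : List ℕ} {zss} e →
  cells (scanl _+_ e (map length (xss ++ ys ∷ zss))) (suc (length xss)) ≡
  e + length (concat xss) + length ys
cells-next-offset [] e = cong (_+ _) (sym (ℕ.+-identityʳ e))
cells-next-offset (xs ∷ xss) {ys} e = trans (cells-next-offset xss (e + length xs))
  (cong (_+ length ys) (trans (ℕ.+-assoc e _ _) (cong (e +_) (sym (List.length-++ xs)))))

cells-concat : ∀ xss {ys b zs} {zss : List (List ℕ)} →
  cells (concat (xss ++ (ys ++ b ∷ zs) ∷ zss)) (length (concat xss) + length ys) ≡ b
cells-concat xss {ys} {b} {zs} {zss} = trans (cong₂ cells
  (begin
    concat (xss ++ (ys ++ b ∷ zs) ∷ zss)
      ≡⟨ List.concat-++ xss _ ⟨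
    concat xss ++ (ys ++ b ∷ zs) ++ concat zss
      ≡⟨ cong (concat xss ++_) (List.++-assoc ys _ _) ⟩
    concat xss ++ ys ++ b ∷ zs ++ concat zss
      ≡⟨ List.++-assoc (concat xss) ys _ ⟨
    (concat xss ++ ys) ++ b ∷ zs ++ concat zss ∎)
  (sym (List.length-++ (concat xss))))
  (cells-++ (concat xss ++ ys))
  where open ≡-Reasoning

-- Total correctness with exact running time: Q relates the final state to
-- the time t already spent before p plus the time of p.
record Reach (p : Program) (Q : State → ℕ → Set) (s : State) (t : ℕ) : Set where
  constructor reach
  field
    {final} : State
    {time}  : ℕ
    run     : Run p s final time
    post    : Q final (time + t)

module _ {Q : State → ℕ → Set} where

  infixr 5 _▸_

  _▸_ : ∀ {p q s s′ t} → Run p s s′ 1 → Reach q Q s′ (suc t) → Reach (p ⨾ q) Q s t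
  _▸_ {t = t} r (reach {time = u} r′ post) =
    reach (r ⨾ r′) (subst (Q _) (ℕ.+-suc u t) post)

  done : ∀ {p s s′ t} → Run p s s′ 1 → Q s′ (suc t) → Reach p Q s t
  done = reach

  weaken : ∀ {Q′ : State → ℕ → Set} {p s t} → (∀ {s t} → Q s t → Q′ s t) →
    Reach p Q s t → Reach p Q′ s t
  weaken Q⇒Q′ (reach r post) = reach r (Q⇒Q′ post)

  sequence : ∀ {p q s t} → Reach p (Reach q Q) s t → Reach (p ⨾ q) Q s t
  sequence {t = t} (reach {time = u} r (reach {time = v} r′ post)) =
    reach (r ⨾ r′) (subst (Q _)
      (trans (sym (ℕ.+-assoc v u t)) (cong (_+ t) (ℕ.+-comm v u))) post)

  branch-true : ∀ {i j p q s t} → reg s i < reg s j →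
    Reach p Q s (suc t) → Reach (if i < j then p else q) Q s t
  branch-true {t = t} i<j (reach {time = u} r post) =
    reach (if-true i<j r) (subst (Q _) (ℕ.+-suc u t) post)

  branch-false : ∀ {i j p q s t} → ¬ (reg s i < reg s j) →
    Reach q Q s (suc t) → Reach (if i < j then p else q) Q s t
  branch-false {t = t} i≮j (reach {time = u} r post) =
    reach (if-false i≮j r) (subst (Q _) (ℕ.+-suc u t) post)

  -- A list that exists only in the proof drives the loop, one element per iteration, and recursion
  -- on its remaining suffix gives termination. Each `suc t` pays for one test of the guard.
  loop-over : ∀ {A : Set} (Inv : List A → State → ℕ → Set) {i j p} xs →
    (∀ {ys x zs s t} → ys ++ x ∷ zs ≡ xs → Inv ys s t →
      reg s i < reg s j × Reach p (Inv (ys ∷ʳ x)) s (suc t)) →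
    (∀ {s t} → Inv xs s t → ¬ (reg s i < reg s j) × Q s (suc t)) →
    ∀ {s t} → Inv [] s t → Reach (while i < j loop p) Q s t
  loop-over Inv {i} {j} {p} xs step exit = go [] xs refl
    where
    go : ∀ ys zs → ys ++ zs ≡ xs → ∀ {s t} → Inv ys s t → Reach (while i < j loop p) Q s t
    go ys [] refl inv with i≮j , post ← exit (subst (λ l → Inv l _ _) (sym (List.++-identityʳ ys)) inv) =
      reach (while-false i≮j) post
    go ys (z ∷ zs) eq {t = t} inv
      with i<j , reach {time = u} r inv′ ← step eq inv
      with reach {time = v} r′ post ← go (ys ∷ʳ z) zs (trans (List.++-assoc ys _ zs) eq) inv′ =
      reach (while-true i<j r r′) (subst (Q _) arith post)
      where
      arith : v + (u + suc t) ≡ suc (u + v) + t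
      arith = trans (cong (v +_) (ℕ.+-suc u t)) (trans (ℕ.+-suc v (u + t))
        (cong suc (trans (sym (ℕ.+-assoc v u t)) (cong (_+ t) (ℕ.+-comm v u)))))

-- The program

-- Registers: 0 |V|, 1 position i, 2 the vertex v at position i, 3 and 4 the
-- current cell and the end of the list of v, 5 its neighbour u, 6 position
-- of u, 7 number of edges found.  Array 5 is the inverse of σ.

invert emit visit scan program : Program

invert = load 6 2 1 ⨾ store 5 6 1 ⨾ inc 1

emit =
  (if 2 < 5 then store 3 7 2 ⨾ store 4 7 5 else (store 3 7 5 ⨾ store 4 7 2)) ⨾
  inc 7

visit = load 5 1 3 ⨾ load 6 2 5 ⨾ (if 1 < 6 then emit else skip) ⨾ inc 3

scan =
  load 2 5 1 ⨾ load 3 0 2 ⨾ copy 4 2 ⨾ inc 4 ⨾ load 4 0 4 ⨾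
  (while 3 < 4 loop visit) ⨾ inc 1

program = (while 1 < 0 loop invert) ⨾ const 1 0 ⨾ while 1 < 0 loop scan

length-∷ʳ : ∀ {A : Set} (xs : List A) {x} → length (xs ∷ʳ x) ≡ suc (length xs)
length-∷ʳ xs = trans (List.length-++ xs) (ℕ.+-comm (length xs) 1)

allFin-image : ∀ {n} {B : Set} (f : Fin n → B) v →
  ∃[ bs ] ∃[ cs ] (map f (allFin n) ≡ bs ++ f v ∷ cs × length bs ≡ toℕ v)
allFin-image {n} f v with us , ws , eq ← ∈-∃++ (∈-allFin v) =
  map f us , map f ws , trans (cong (map f) eq) (List.map-++ f us (v ∷ ws)) ,
  trans (List.length-map f us) (sym (allFin-split (sym eq)))

-- Including guard tests, an inversion costs 4, a scanned vertex 8 and a visited dart at most 9;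
-- leaving the loops and resetting the counter add 3. Two darts per edge give 18 per edge, which
-- also covers the 12 per vertex and the additive term.
time-bound : ∀ n m {d} → d ≤ m + m →
  suc (n * 8 + d * 9 + (2 + n * 4)) ≤ 18 * (n + m) + 18
time-bound n m {d} d≤ = begin
  suc (n * 8 + d * 9 + (2 + n * 4))
    ≤⟨ s≤s (ℕ.+-monoˡ-≤ (2 + n * 4) (ℕ.+-monoʳ-≤ (n * 8) (ℕ.*-monoˡ-≤ 9 d≤))) ⟩
  suc (n * 8 + (m + m) * 9 + (2 + n * 4))
    ≤⟨ ℕ.m≤m+n (suc (n * 8 + (m + m) * 9 + (2 + n * 4))) (n * 6 + 15) ⟩
  suc (n * 8 + (m + m) * 9 + (2 + n * 4)) + (n * 6 + 15)
    ≡⟨ solve 2 (λ n m → con 1 :+ (n :* con 8 :+ (m :+ m) :* con 9 :+ (con 2 :+ n :* con 4))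
           :+ (n :* con 6 :+ con 15) := con 18 :* (n :+ m) :+ con 18) refl n m ⟩
  18 * (n + m) + 18 ∎
  where
  open ℕ.≤-Reasoning
  open +-*-Solver

-- Correctness and running time of the program

module Correctness (G : AdjacencyLists) (σ : Ordering (Fin (order G))) where
  open Enumeration G σ

  rank : Fin (order G) → ℕ
  rank v = toℕ (position σ v)

  offset : Fin (order G) → ℕ
  offset v = arr (input G σ) 0 (toℕ v)

  private
    list : Fin (order G) → List ℕ
    list v = map toℕ (nbrs G v)

  input-end : ∀ v → arr (input G σ) 0 (suc (toℕ v)) ≡ offset v + length (nbrs G v)
  input-end v with bs , cs , eq , len ← allFin-image list v = begin
    cells (scanl _+_ 0 (map length (map list (allFin _)))) (suc (toℕ v))
      ≡⟨ cong₂ (λ l k → cells (scanl _+_ 0 (map length l)) (suc k)) eq (sym len) ⟩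
    cells (scanl _+_ 0 (map length (bs ++ list v ∷ cs))) (suc (length bs))
      ≡⟨ cells-next-offset bs 0 ⟩
    length (concat bs) + length (list v)
      ≡⟨ cong₂ _+_ (sym (cells-offset bs 0)) (List.length-map toℕ (nbrs G v)) ⟩
    cells (scanl _+_ 0 (map length (bs ++ list v ∷ cs))) (length bs) + length (nbrs G v)
      ≡⟨ cong (_+ length (nbrs G v))
           (cong₂ (λ l k → cells (scanl _+_ 0 (map length l)) k) (sym eq) len) ⟩
    offset v + length (nbrs G v) ∎
    where open ≡-Reasoning

  input-neighbour : ∀ v {us u ws} → us ++ u ∷ ws ≡ nbrs G v →
    arr (input G σ) 1 (offset v + length us) ≡ toℕ u
  input-neighbour v {us} {u} {ws} parts with bs , cs , eq , len ← allFin-image list v = begin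
    cells (concat (map list (allFin _))) (offset v + length us)
      ≡⟨ cong₂ (λ l k → cells (concat l) k)
           (trans eq (cong (λ l → bs ++ l ∷ cs)
             (trans (cong (map toℕ) (sym parts)) (List.map-++ toℕ us (u ∷ ws)))))
           (cong₂ _+_
             (trans (cong₂ (λ l k → cells (scanl _+_ 0 (map length l)) k) eq (sym len))
               (cells-offset bs 0))
             (sym (List.length-map toℕ us))) ⟩
    cells (concat (bs ++ (map toℕ us ++ toℕ u ∷ map toℕ ws) ∷ cs))
      (length (concat bs) + length (map toℕ us))
      ≡⟨ cells-concat bs ⟩
    toℕ u ∎
    where open ≡-Reasoning

  input-rank : ∀ v → arr (input G σ) 2 (toℕ v) ≡ rank v
  input-rank v with bs , cs , eq , len ← allFin-image rank v =
    trans (cong₂ cells eq (sym len)) (cells-++ bs)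

  -- Indexed by the registers and arrays concerned rather than by a state: after a write elsewhere
  -- these indices reduce to the same terms, and the invariant carries over as it is.
  record Contents (us : List (Fin (order G))) (es : List Dart) (n m : ℕ)
                  (offs heads ranks srcs tgts inverse : ℕ → ℕ) : Set where
    field
      n≡       : n ≡ order G
      m≡       : m ≡ length es
      offs≡    : offs ≡ arr (input G σ) 0
      heads≡   : heads ≡ arr (input G σ) 1
      ranks≡   : ranks ≡ arr (input G σ) 2
      srcs≗    : ∀ i → srcs i ≡ cells (map low es) i
      tgts≗    : ∀ i → tgts i ≡ cells (map high es) i
      inverse≡ : ∀ {v} → v ∈ us → inverse (rank v) ≡ toℕ v

  -- The vertices us have been entered in the inverse of σ, the edges es
  -- have been written.
  Memory : List (Fin (order G)) → List Dart → State → Set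
  Memory us es s = Contents us es (reg s 0) (reg s 7)
    (arr s 0) (arr s 1) (arr s 2) (arr s 3) (arr s 4) (arr s 5)

  record Inverting (us : List (Fin (order G))) (s : State) (t : ℕ) : Set where
    field
      memory : Memory us [] s
      next   : reg s 1 ≡ length us
      bound  : t ≤ length us * 4

  invert-step : ∀ {us v ws s t} → us ++ v ∷ ws ≡ allFin (order G) → Inverting us s t →
    reg s 1 < reg s 0 × Reach invert (Inverting (us ∷ʳ v)) s (suc t)
  invert-step {us} {v} {ws} {s} parts I =
    subst₂ _<_ next′ (sym n≡) (Fin.toℕ<n v) ,
    (load ▸ store ▸ done inc record
      { memory = record { Contents memory ; inverse≡ = inverse′ }
      ; next = trans (cong suc next) (sym (length-∷ʳ us))
      ; bound = ℕ.≤-trans (ℕ.+-monoʳ-≤ 4 bound)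
          (ℕ.≤-reflexive (cong (_* 4) (sym (length-∷ʳ us)))) })
    where
    open Inverting I
    open Contents memory
    next′ : toℕ v ≡ reg s 1
    next′ = trans (allFin-split parts) (sym next)
    loaded : arr s 2 (reg s 1) ≡ rank v
    loaded = trans (cong₂ (λ f i → f i) ranks≡ (sym next′)) (input-rank v)
    inverse′ : ∀ {w} → w ∈ us ∷ʳ v →
      update (arr s 5) (arr s 2 (reg s 1)) (reg s 1) (rank w) ≡ toℕ w
    inverse′ {w} w∈ rewrite loaded with v Fin.≟ w | ∈-++⁻ us w∈
    ... | yes refl | _ = trans (update-same (arr s 5) (rank v)) (sym next′)
    ... | no v≢w | inj₁ w∈us =
      trans (update-other (arr s 5) (v≢w ∘ position-injective σ ∘ Fin.toℕ-injective))
        (inverse≡ w∈us)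
    ... | no v≢w | inj₂ (here refl) = ⊥-elim (v≢w refl)

  forwardEdges : List Dart → List Dart
  forwardEdges = filter forward?

  record Visiting (us : List (Fin (order G))) (v : Fin (order G)) (b : ℕ)
                  (ns : List (Fin (order G))) (s : State) (t : ℕ) : Set where
    field
      memory  : Memory (allFin (order G)) (forwardEdges (darts us ++ dartsFrom v ns)) s
      counter : reg s 1 ≡ rank v
      vertex  : reg s 2 ≡ toℕ v
      next    : reg s 3 ≡ offset v + length ns
      end     : reg s 4 ≡ offset v + length (nbrs G v)
      bound   : t ≤ length ns * 9 + b

  -- A frame condition. The two branches of `emit` end in different state expressions but take the
  -- same time and preserve registers 1 to 4, which is all that the surrounding invariant needs.
  Emitted : List Dart → State → ℕ → State → ℕ → Set
  Emitted es s t s′ t′ = Memory (allFin (order G)) es s′ × t′ ≡ 4 + t ×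
    reg s′ 1 ≡ reg s 1 × reg s′ 2 ≡ reg s 2 × reg s′ 3 ≡ reg s 3 × reg s′ 4 ≡ reg s 4

  emit-step : ∀ {es v u s t} → Memory (allFin (order G)) es s →
    reg s 2 ≡ toℕ v → reg s 5 ≡ toℕ u →
    Reach emit (Emitted (es ∷ʳ (v , u)) s t) s t
  emit-step {es} {v} {u} {s} {t} M v≡ u≡ = sequence choice
    where
    open Contents M
    appended : ∀ (f : Dart → ℕ) {a g} → (∀ i → g i ≡ cells (map f es) i) → a ≡ f (v , u) →
      ∀ i → update g (reg s 7) a i ≡ cells (map f (es ∷ʳ (v , u))) i
    appended f g≗ refl i = trans
      (update-∷ʳ (map f es) (trans m≡ (sym (List.length-map f es))) g≗ i)
      (cong (λ l → cells l i) (sym (List.map-++ f es _)))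
    written : ∀ {a b} → a ≡ low (v , u) → b ≡ high (v , u) →
      Memory (allFin (order G)) (es ∷ʳ (v , u))
        (setReg (setArr (setArr s 3 (reg s 7) a) 4 (reg s 7) b) 7 (suc (reg s 7)))
    written a≡ b≡ = record
      { Contents M
      ; m≡ = trans (cong suc m≡) (sym (length-∷ʳ es))
      ; srcs≗ = appended low srcs≗ a≡
      ; tgts≗ = appended high tgts≗ b≡ }
    choice : Reach (if 2 < 5 then store 3 7 2 ⨾ store 4 7 5 else (store 3 7 5 ⨾ store 4 7 2))
      (Reach (inc 7) (Emitted (es ∷ʳ (v , u)) s t)) s t
    choice with reg s 2 <? reg s 5
    ... | yes v<u = branch-true v<u (store ▸ done store (done inc
      ( written (trans v≡ (sym (ℕ.m≤n⇒m⊓n≡m v≤u))) (trans u≡ (sym (ℕ.m≤n⇒m⊔n≡n v≤u)))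
      , refl , refl , refl , refl , refl )))
      where v≤u = ℕ.<⇒≤ (subst₂ _<_ v≡ u≡ v<u)
    ... | no v≮u = branch-false v≮u (store ▸ done store (done inc
      ( written (trans u≡ (sym (ℕ.m≥n⇒m⊓n≡n u≤v))) (trans v≡ (sym (ℕ.m≥n⇒m⊔n≡m u≤v)))
      , refl , refl , refl , refl , refl )))
      where u≤v = subst₂ _≤_ u≡ v≡ (ℕ.≮⇒≥ v≮u)

  visit-step : ∀ {us v b ns u ws s t} → ns ++ u ∷ ws ≡ nbrs G v → Visiting us v b ns s t →
    reg s 3 < reg s 4 × Reach visit (Visiting us v b (ns ∷ʳ u)) s (suc t)
  visit-step {us} {v} {b} {ns} {u} {ws} {s} {t} parts V =
    subst₂ _<_ (sym next) (sym end) (ℕ.+-monoʳ-< (offset v) ns<) ,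
    load ▸ load ▸ sequence choice
    where
    open Visiting V
    open Contents memory
    ns< : length ns < length (nbrs G v)
    ns< = subst (length ns <_) (trans (sym (List.length-++ ns)) (cong length parts))
      (ℕ.m<m+n (length ns) (s≤s z≤n))
    loaded : arr s 1 (reg s 3) ≡ toℕ u
    loaded = trans (cong₂ (λ f i → f i) heads≡ next) (input-neighbour v parts)
    loaded-rank : arr s 2 (arr s 1 (reg s 3)) ≡ rank u
    loaded-rank = trans (cong₂ (λ f i → f i) ranks≡ loaded) (input-rank u)
    s′ : State
    s′ = setReg (setReg s 5 (arr s 1 (reg s 3))) 6 (arr s 2 (arr s 1 (reg s 3)))
    extended : forwardEdges (darts us ++ dartsFrom v (ns ∷ʳ u)) ≡
      forwardEdges (darts us ++ dartsFrom v ns) ++ forwardEdges [ v , u ]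
    extended = trans (cong forwardEdges (trans
        (cong (darts us ++_) (List.map-++ (v ,_) ns [ u ]))
        (sym (List.++-assoc (darts us) _ _))))
      (List.filter-++ forward? (darts us ++ dartsFrom v ns) [ v , u ])
    next′ : suc (reg s 3) ≡ offset v + length (ns ∷ʳ u)
    next′ = trans (cong suc next) (trans (sym (ℕ.+-suc (offset v) _))
      (cong (offset v +_) (sym (length-∷ʳ ns))))
    bound′ : 9 + t ≤ length (ns ∷ʳ u) * 9 + b
    bound′ = ℕ.≤-trans (ℕ.+-monoʳ-≤ 9 bound)
      (ℕ.≤-reflexive (cong (λ l → l * 9 + b) (sym (length-∷ʳ ns))))
    choice : Reach (if 1 < 6 then emit else skip)
      (Reach (inc 3) (Visiting us v b (ns ∷ʳ u))) s′ (3 + t)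
    choice with forward? (v , u)
    ... | yes v≺u = branch-true (subst₂ _<_ (sym counter) (sym loaded-rank) v≺u)
      (weaken emitted (emit-step {s = s′} memory vertex loaded))
      where
      emitted : ∀ {s″ t″} →
        Emitted (forwardEdges (darts us ++ dartsFrom v ns) ∷ʳ (v , u)) s′ (4 + t) s″ t″ →
        Reach (inc 3) (Visiting us v b (ns ∷ʳ u)) s″ t″
      emitted {s″} (M , refl , r1 , r2 , r3 , r4) = done inc record
        { memory = subst (λ es → Memory (allFin (order G)) es s″) (sym (trans extended
            (cong (forwardEdges (darts us ++ dartsFrom v ns) ++_)
              (List.filter-accept forward? v≺u)))) M
        ; counter = trans r1 counter
        ; vertex = trans r2 vertex
        ; next = trans (cong suc r3) next′
        ; end = trans r4 end
        ; bound = bound′ }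
    ... | no v⊀u = branch-false (λ i<j → v⊀u (subst₂ _<_ counter loaded-rank i<j))
      (done skip (done inc record
         { memory = subst (λ es → Memory (allFin (order G)) es s) (sym (trans extended (trans
             (cong (forwardEdges (darts us ++ dartsFrom v ns) ++_)
               (List.filter-reject forward? v⊀u)) (List.++-identityʳ _)))) memory
         ; counter = counter
         ; vertex = vertex
         ; next = next′
         ; end = end
         -- A backward dart is cheaper by 3: `skip` takes one step where `emit` takes four.
         ; bound = ℕ.≤-trans (ℕ.m≤n+m _ 3) bound′ }))

  record Scanning (b : ℕ) (us : List (Fin (order G))) (s : State) (t : ℕ) : Set where
    field
      memory  : Memory (allFin (order G)) (forwardEdges (darts us)) s
      next    : reg s 1 ≡ length us
      bound   : t ≤ length us * 8 + length (darts us) * 9 + b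

  scan-step : ∀ {b us v ws s t} → us ++ v ∷ ws ≡ sorted → Scanning b us s t →
    reg s 1 < reg s 0 × Reach scan (Scanning b (us ∷ʳ v)) s (suc t)
  scan-step {b} {us} {v} {ws} {s} {t} parts S =
    subst₂ _<_ (sym counter) (trans size≡order (sym n≡)) (Fin.toℕ<n (position σ v)) ,
    load ▸ load ▸ copy ▸ inc ▸ load ▸ sequence
      -- The 6 is the outer guard test and the five instructions before the inner loop; the 2 in
      -- `bound₁` is the failing inner test and the final `inc 1`.
      (loop-over (Visiting us v (6 + bound₀)) (nbrs G v) visit-step exit record
        { memory = subst (λ es → Memory (allFin (order G)) es s)
            (cong forwardEdges (sym (List.++-identityʳ (darts us)))) memory
        ; counter = counter
        ; vertex = loaded
        ; next = trans (cong₂ (λ f i → f i) offs≡ loaded) (sym (ℕ.+-identityʳ (offset v)))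
        ; end = trans (cong₂ (λ f i → f (suc i)) offs≡ loaded) (input-end v)
        ; bound = ℕ.+-monoʳ-≤ 6 bound })
    where
    open Scanning S
    open Contents memory
    bound₀ : ℕ
    bound₀ = length us * 8 + length (darts us) * 9 + b
    counter : reg s 1 ≡ rank v
    counter = trans next (sym (sorted-split parts))
    loaded : arr s 5 (reg s 1) ≡ toℕ v
    loaded = trans (cong (arr s 5) counter) (inverse≡ (∈-allFin v))
    bound₁ : 2 + (length (nbrs G v) * 9 + (6 + bound₀)) ≡
      length (us ∷ʳ v) * 8 + length (darts (us ∷ʳ v)) * 9 + b
    bound₁ = trans
      (solve 4 (λ l d m b → con 2 :+ (m :* con 9 :+ (con 6 :+ (l :* con 8 :+ d :* con 9 :+ b)))
          := (con 1 :+ l) :* con 8 :+ (d :+ m) :* con 9 :+ b)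
        refl (length us) (length (darts us)) (length (nbrs G v)) b)
      (cong₂ (λ l d → l * 8 + d * 9 + b) (sym (length-∷ʳ us)) (sym (trans
        (cong length (darts-∷ʳ us v)) (trans (List.length-++ (darts us))
          (cong (length (darts us) +_) (List.length-map (v ,_) (nbrs G v)))))))
      where open +-*-Solver
    exit : ∀ {s t} → Visiting us v (6 + bound₀) (nbrs G v) s t →
      ¬ (reg s 3 < reg s 4) × Reach (inc 1) (Scanning b (us ∷ʳ v)) s (suc t)
    exit {s} V = (λ 3<4 → ℕ.<-irrefl (trans V.next (sym V.end)) 3<4) , done inc record
      { memory = subst (λ es → Memory (allFin (order G)) es s) (cong forwardEdges (sym (darts-∷ʳ us v))) V.memory
      ; next = trans (cong suc (trans V.counter (sorted-split parts))) (sym (length-∷ʳ us))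
      ; bound = ℕ.≤-trans (ℕ.+-monoʳ-≤ 2 V.bound) (ℕ.≤-reflexive bound₁) }
      where module V = Visiting V

  Final : State → ℕ → Set
  Final s t = Memory (allFin (order G)) edges s ×
    t ≤ suc (order G * 8 + length (darts sorted) * 9 + (2 + order G * 4))

  program-reaches : Reach program Final (input G σ) 0
  program-reaches = sequence (loop-over Inverting (allFin (order G)) invert-step inverted record
    { memory = record
        { n≡ = refl ; m≡ = refl ; offs≡ = refl ; heads≡ = refl ; ranks≡ = refl
        ; srcs≗ = λ _ → refl ; tgts≗ = λ _ → refl ; inverse≡ = λ () }
    ; next = refl
    ; bound = z≤n })
    where
    scanned : ∀ {s t} → Scanning (2 + order G * 4) sorted s t →
      ¬ (reg s 1 < reg s 0) × Final s (suc t)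
    scanned S =
      (λ i<n → ℕ.<-irrefl (trans next (trans length-sorted (sym (Contents.n≡ memory)))) i<n) ,
      memory , s≤s (subst (λ l → _ ≤ l * 8 + length (darts sorted) * 9 + (2 + order G * 4)) length-sorted bound)
      where open Scanning S
    inverted : ∀ {s t} → Inverting (allFin (order G)) s t →
      ¬ (reg s 1 < reg s 0) × Reach (const 1 0 ⨾ while 1 < 0 loop scan) Final s (suc t)
    inverted I =
      (λ i<n → ℕ.<-irrefl (trans next (trans length-allFin (sym (Contents.n≡ memory)))) i<n) ,
      (const ▸ loop-over (Scanning (2 + order G * 4)) sorted scan-step scanned record
        { memory = memory
        ; next = refl
        ; bound = s≤s (s≤s (subst (λ l → _ ≤ l * 4) length-allFin bound)) })
      where
      open Inverting I
      length-allFin : length (allFin (order G)) ≡ order G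
      length-allFin = List.length-tabulate {n = order G} _

  memory⇒outputs : ∀ {us s} → Memory us edges s → Outputs G s edgeOrdering
  memory⇒outputs M e =
    trans (srcs≗ i) (trans (trans (cells-map-lookup low edges _) (cong low (lookup-edges e)))
      (sym (Oriented.src-⊓ G σ e))) ,
    trans (tgts≗ i) (trans (trans (cells-map-lookup high edges _) (cong high (lookup-edges e)))
      (sym (Oriented.tgt-⊔ G σ e)))
    where
    open Contents M
    i : ℕ
    i = toℕ (position edgeOrdering e)

  program-correct : ∃[ s ] ∃[ t ] (Run program (input G σ) s t × Outputs G s edgeOrdering ×
    t ≤ 18 * (order G + size edgeOrdering) + 18)
  program-correct = R.final , R.time , R.run ,
    memory⇒outputs {allFin (order G)} {R.final} (proj₁ R.post) ,
    ℕ.≤-trans (ℕ.≤-trans (ℕ.m≤m+n R.time 0) (proj₂ R.post))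
      (time-bound (order G) (size edgeOrdering) handshake)
    where module R = Reach program-reaches

edgeOrdering-free : ∀ 𝒢 {G σ} → PatternFree 𝒢 ⟦ G ⟧ σ →
  PatternFree 𝒢 (L² G) (Enumeration.edgeOrdering G σ)
edgeOrdering-free 𝒢 {G} {σ} = PatternFree-L² {G} {σ} (Enumeration.edgeOrdering G σ)
  (λ {e} {f} → Enumeration.edgeOrdering-mono G σ {e} {f}) 𝒢

corollary5 : (𝒢 : Class) →
    ((G : AdjacencyLists) → ⟦ G ⟧ ∈Class 𝒢 →
    (σ : Ordering (Fin (order G))) → PatternFree 𝒢 ⟦ G ⟧ σ →
    (Σ[ τ ∈ Ordering (Edge G) ] PatternFree 𝒢 (L² G) τ) ×
    (L² G ∈Class 𝒢))
    ×
    (Σ[ program ∈ Program ] Σ[ c ∈ ℕ ]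
    ((G : AdjacencyLists) → ⟦ G ⟧ ∈Class 𝒢 →
    (σ : Ordering (Fin (order G))) → PatternFree 𝒢 ⟦ G ⟧ σ →
    Σ[ τ ∈ Ordering (Edge G) ] (PatternFree 𝒢 (L² G) τ ×
    (∃[ s ] ∃[ t ] (Run program (input G σ) s t ×
    Outputs G s τ ×
    t ≤ c * (order G + size τ) + c)))))
corollary5 𝒢 =
  (λ G G∈ σ free → let τ = Enumeration.edgeOrdering G σ ; free′ = edgeOrdering-free 𝒢 {G} {σ} free
    in (τ , free′) , L²-∈Class 𝒢 {G} {σ} G∈ free τ free′) ,
  program , 18 , λ G _ σ free →
    Enumeration.edgeOrdering G σ , edgeOrdering-free 𝒢 {G} {σ} free ,
    Correctness.program-correct G σ
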